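{- Fix $\alpha\in(0,1)$ and an integer $\lambda\ge0$. For the online time-critical task scheduling with calibration problem in which all jobs are $\alpha$-short window jobs (i.e., $d_j-r_j<\alpha T+\lambda$), with unit processing times and activation time $\lambda$, there exists an online algorithm with competitive ratio $(e+1)(\lambda+1)\lceil\frac{2}{1-\alpha}\rceil$.
   Context: Problem: unlimited identical machines; discrete time. A calibration started at integer time $t$ occupies $[t,t+\lambda+T)$, with activation interval $[t,t+\lambda)$ and calibrated interval $[t+\lambda,t+\lambda+T)$ ($T$ a positive integer). Machines process jobs only while calibrated, one job at a time. Each job $j$ has integer release time $r_j$, processing time $1$, integer deadline $d_j$ with $d_j-r_j\ge1+\lambda$; scheduling $j$ at integer time $\tau$ in a calibrated slot is feasible iff $r_j\le\tau$ and $\tau+1\le d_j$. Jobs arrive online (revealed at release time). Objective: minimize the number of calibrations while feasibly scheduling all jobs. An online algorithm is $c$-competitive if there is a constant $a$ with $ALG(Ins)\le c\cdot OPT(Ins)+a$ for every instance, where $OPT(Ins)$ is the minimum number of calibrations.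
   Formalization: The parameter α is taken rational instead of real in (0,1); the real case follows by replacing α with 1−2/⌈2/(1−α)⌉, which is rational, at least α, and has the same ceiling. -}

module Defs where

open import Data.Nat using (ℕ; zero; suc; _+_; _*_; _∸_; _≤_; _<_; _!)
open import Data.Nat.Properties using (_!≢0)
open import Data.Integer as ℤ using (ℤ; +_; +[1+_]; -[1+_])
open import Data.Rational as ℚ using (ℚ; mkℚ; _/_; _÷_; ceiling) renaming (_+_ to _+ℚ_; _-_ to _-ℚ_; _≤_ to _≤ℚ_)
open import Data.List using (List; []; length; lookup; map; upTo)
open import Data.Nat.ListAction using (sum)
open import Data.List.Relation.Unary.All using (All)
open import Data.List.Relation.Unary.Unique.Propositional using (Unique)
open import Data.List.Membership.Propositional using (_∈_)
open import Data.Vec using (Vec; tabulate)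
open import Data.Fin using (Fin; toℕ)
open import Data.Product using (Σ; ∃; _×_; _,_; proj₁; proj₂)
open import Relation.Binary.PropositionalEquality using (_≡_)
open import Function.Definitions using (Injective)

ℕ→ℚ : ℕ → ℚ
ℕ→ℚ n = + n / 1

ℤ→ℚ : ℤ → ℚ
ℤ→ℚ z = z / 1

-- ⌈ 2 / (1 - α) ⌉  (library division and ceiling; the value returned when
-- 1 - α = 0 is an irrelevant junk value, since the theorem assumes α < 1)
ceil2div1minus : ℚ → ℤ
ceil2div1minus α with 1ℚ' -ℚ α
  where 1ℚ' = + 1 / 1
... | q@(mkℚ +[1+ n ] _ _) = ceiling ((+ 2 / 1) ÷ q)
... | q@(mkℚ -[1+ n ] _ _) = ceiling ((+ 2 / 1) ÷ q)
... | mkℚ (+ zero) _ _     = + 0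

eSum : ℕ → ℚ
eSum zero    = + 1 / 1
eSum (suc n) = eSum n +ℚ ((+ 1 / (suc n !)) {{suc n !≢0}})

-- eUpper n = Σ_{k=0}^{n+1} 1/k! + 1/((n+1)·(n+1)!)  > e, and eUpper n ↓ e.
eUpper : ℕ → ℚ
eUpper n = eSum (suc n) +ℚ ((+ 1 / (suc n * suc n !)) {{nz}})
  where
  nz : Data.Nat.NonZero (suc n * suc n !)
  nz = Data.Nat.Properties.m*n≢0 (suc n) (suc n !) {{_}} {{suc n !≢0}}

-- "q > e" : q dominates one of the upper bounds eUpper n.
-- (The set of such q is exactly the open ray (e, ∞).)
AboveE : ℚ → Set
AboveE q = ∃ λ n → eUpper n ≤ℚ q

-- Instances.  Times are natural numbers.  arr t is the list of deadlines
-- of the jobs released at time t; job (t , i) is the i-th job released at t.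

record Instance : Set where
  field
    arr     : ℕ → List ℕ
    horizon : ℕ
    finite  : ∀ t → horizon ≤ t → arr t ≡ []
open Instance public

Job : Instance → Set
Job I = Σ ℕ λ s → Fin (length (arr I s))

release : (I : Instance) → Job I → ℕ
release I (s , i) = s

deadline : (I : Instance) → Job I → ℕ
deadline I (s , i) = lookup (arr I s) i

WellFormed : (lam : ℕ) → Instance → Set
WellFormed lam I = ∀ (j : Job I) → release I j + suc lam ≤ deadline I j

AlphaShort : (α : ℚ) (T lam : ℕ) → Instance → Set
AlphaShort α T lam I = ∀ (j : Job I) →
  ℕ→ℚ (deadline I j ∸ release I j) ℚ.< (α ℚ.* ℕ→ℚ T) +ℚ ℕ→ℚ lam

-- Offline schedules (unlimited machines).  A schedule is a list of
-- calibration start times and a placement of each job into a slot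
-- (calibration, integer time τ); at most one job per slot.

record Schedule (T lam : ℕ) (I : Instance) : Set where
  field
    cals  : List ℕ
    place : Job I → Fin (length cals) × ℕ
    inj   : Injective _≡_ _≡_ place
    rel   : ∀ j → release I j ≤ proj₂ (place j)
    dl    : ∀ j → suc (proj₂ (place j)) ≤ deadline I j
    calLo : ∀ j → lookup cals (proj₁ (place j)) + lam ≤ proj₂ (place j)
    calHi : ∀ j → proj₂ (place j) < lookup cals (proj₁ (place j)) + lam + T
open Schedule public

-- Online (deterministic) algorithms.
-- At time t the algorithm sees the history arr 0 , … , arr t (all jobs
-- released so far) and decides (a) how many calibrations to start at t and
-- (b) which jobs to process at t, on which calibrations.
-- A job id is (release time s , index i); a calibration id is
-- (start time u , k) meaning the k-th calibration started at time u.

JobId : Set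
JobId = ℕ × ℕ

CalId : Set
CalId = ℕ × ℕ

record Decision : Set where
  field
    calibs : ℕ
    runs   : List (JobId × CalId)
open Decision public

OnlineAlg : Set
OnlineAlg = (t : ℕ) → Vec (List ℕ) (suc t) → Decision

history : Instance → (t : ℕ) → Vec (List ℕ) (suc t)
history I t = tabulate (λ i → arr I (toℕ i))

dec : OnlineAlg → Instance → ℕ → Decision
dec A I t = A t (history I t)

CalibratedAt : (T lam : ℕ) → OnlineAlg → Instance → CalId → ℕ → Set
CalibratedAt T lam A I (u , k) t =
  (k < calibs (dec A I u)) × (u + lam ≤ t) × (t < u + lam + T)

LegalRun : (T lam : ℕ) → OnlineAlg → Instance → ℕ → JobId × CalId → Set
LegalRun T lam A I t ((s , i) , c) =
  Σ (i < length (arr I s)) λ _ →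
    (s ≤ t) × (∀ (j : Fin (length (arr I s))) → toℕ j ≡ i → suc t ≤ lookup (arr I s) j)
    × CalibratedAt T lam A I c t

Feasible : (T lam : ℕ) → OnlineAlg → Instance → Set
Feasible T lam A I =
  (∀ t → All (LegalRun T lam A I t) (runs (dec A I t)))
  × (∀ t → Unique (map proj₂ (runs (dec A I t))))
  × (∀ (j : Job I) → ∃ λ t → ∃ λ c → ((proj₁ j , toℕ (proj₂ j)) , c) ∈ runs (dec A I t))

algCalibs : OnlineAlg → Instance → ℕ → ℕ
algCalibs A I N = sum (map (λ t → calibs (dec A I t)) (upTo N))

{-# OPTIONS --safe #-}
module Submission where

-- Delay every job by lam: replacing each calibration of an offline schedule by lam + 1
-- copies, started 0, …, lam steps later, accommodates the delayed jobs, so this costs a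
-- factor lam + 1 and hides the activation time.
--
-- With k = ⌈2/(1-α)⌉ cut the release times into blocks of length L = ⌈2T/k⌉ and treat the
-- blocks separately.  All jobs of a block live in a window of length T, so a calibration
-- opened for the block lasts until its end; and a calibrated interval meets the windows
-- of at most k blocks.
--
-- Inside a block let m be the largest density ⌈#{jobs with window in [b,D)}/(D-b)⌉ of the
-- jobs seen so far, a lower bound on the number of copies meeting the block's window, and
-- run EDF on 3m machines.  If EDF missed a deadline D, then for some s the jobs due by
-- D and released in [s,D) would exceed the capacity of [s,D).  But at distance x from D,
-- m is at least 1/(2x) times the number of such jobs released at distance between x and 2x,
-- so ∑ m counts a job released at distance z with weight ∑_{z/2≤x≤z} 1/(2x) ≥ 1/3.
-- Finally 3 < e + 1.

module Summation where

  open import Data.Bool using (if_then_else_; true; false)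
  open import Data.List using (List; []; _∷_; _++_; downFrom; filter; length; map; upTo)
  open import Data.List.Membership.Propositional using (_∈_)
  open import Data.List.Membership.Propositional.Properties using (∈-∃++)
  open import Data.List.Properties using (reverse-upTo)
  open import Data.List.Relation.Binary.Permutation.Propositional using (↭-sym)
  open import Data.List.Relation.Binary.Permutation.Propositional.Properties
    using (map⁺; shift; ∈-resp-↭; ↭-reverse)
  import Data.List.Relation.Unary.All as All
  open import Data.List.Relation.Unary.AllPairs using ([]; _∷_)
  open import Data.List.Relation.Unary.Any using (here; there)
  open import Data.List.Relation.Unary.Unique.Propositional using (Unique)
  open import Data.Nat
  open import Data.Nat.ListAction using (sum)
  open import Data.Nat.ListAction.Properties using (sum-↭)
  open import Data.Nat.Properties
  open import Algebra.Properties.CommutativeSemigroup +-commutativeSemigroup using (interchange)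
  open import Data.Product using (∃; _×_; _,_)
  open import Relation.Binary.PropositionalEquality
  open import Relation.Nullary using (Dec; does; contradiction)

  private variable
    A B : Set

  ∑ : List A → (A → ℕ) → ℕ
  ∑ xs f = sum (map f xs)

  syntax ∑ xs (λ x → e) = ∑[ x ∈ xs ] e

  ∑-cong : ∀ (xs : List A) {f g : A → ℕ} → (∀ {x} → x ∈ xs → f x ≡ g x) → ∑ xs f ≡ ∑ xs g
  ∑-cong []       f≡g = refl
  ∑-cong (x ∷ xs) f≡g = cong₂ _+_ (f≡g (here refl)) (∑-cong xs λ x∈xs → f≡g (there x∈xs))

  ∑-mono-≤ : ∀ (xs : List A) {f g : A → ℕ} → (∀ {x} → x ∈ xs → f x ≤ g x) → ∑ xs f ≤ ∑ xs g
  ∑-mono-≤ []       f≤g = z≤n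
  ∑-mono-≤ (x ∷ xs) f≤g = +-mono-≤ (f≤g (here refl)) (∑-mono-≤ xs λ x∈xs → f≤g (there x∈xs))

  ∑-const : ∀ (xs : List A) c → ∑[ _ ∈ xs ] c ≡ length xs * c
  ∑-const []       c = refl
  ∑-const (x ∷ xs) c = cong (c +_) (∑-const xs c)

  ∑-1≡length : ∀ (xs : List A) → ∑[ _ ∈ xs ] 1 ≡ length xs
  ∑-1≡length xs = trans (∑-const xs 1) (*-identityʳ (length xs))

  ∑-distrib-+ : ∀ (xs : List A) (f g : A → ℕ) → ∑[ x ∈ xs ] (f x + g x) ≡ ∑ xs f + ∑ xs g
  ∑-distrib-+ []       f g = refl
  ∑-distrib-+ (x ∷ xs) f g = trans (cong (f x + g x +_) (∑-distrib-+ xs f g))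
                                   (interchange (f x) (g x) (∑ xs f) (∑ xs g))

  *-distribˡ-∑ : ∀ c (xs : List A) (f : A → ℕ) → c * ∑ xs f ≡ ∑[ x ∈ xs ] (c * f x)
  *-distribˡ-∑ c []       f = *-zeroʳ c
  *-distribˡ-∑ c (x ∷ xs) f = trans (*-distribˡ-+ c (f x) (∑ xs f)) (cong (c * f x +_) (*-distribˡ-∑ c xs f))

  *-distribʳ-∑ : ∀ c (xs : List A) (f : A → ℕ) → ∑ xs f * c ≡ ∑[ x ∈ xs ] (f x * c)
  *-distribʳ-∑ c []       f = refl
  *-distribʳ-∑ c (x ∷ xs) f = trans (*-distribʳ-+ c (f x) (∑ xs f)) (cong (f x * c +_) (*-distribʳ-∑ c xs f))

  ∑-swap : ∀ (xs : List A) (ys : List B) (f : A → B → ℕ) →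
           ∑[ x ∈ xs ] ∑[ y ∈ ys ] f x y ≡ ∑[ y ∈ ys ] ∑[ x ∈ xs ] f x y
  ∑-swap []       ys f = sym (trans (∑-const ys 0) (*-zeroʳ (length ys)))
  ∑-swap (x ∷ xs) ys f = trans (cong (∑ ys (f x) +_) (∑-swap xs ys f)) (sym (∑-distrib-+ ys (f x) _))

  ∑-filter : ∀ {P : A → Set} (P? : ∀ x → Dec (P x)) xs (f : A → ℕ) →
             ∑ (filter P? xs) f ≡ ∑[ x ∈ xs ] (if does (P? x) then f x else 0)
  ∑-filter P? []       f = refl
  ∑-filter P? (x ∷ xs) f with does (P? x)
  ... | true  = cong (f x +_) (∑-filter P? xs f)
  ... | false = ∑-filter P? xs f

  ∑-filter-swap : ∀ {R : A → B → Set} (R? : ∀ x y → Dec (R x y)) xs ys (f : A → B → ℕ) →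
                  ∑[ y ∈ ys ] ∑[ x ∈ filter (λ x → R? x y) xs ] f x y ≡
                  ∑[ x ∈ xs ] ∑[ y ∈ filter (R? x) ys ] f x y
  ∑-filter-swap R? xs ys f = begin
    ∑[ y ∈ ys ] ∑[ x ∈ filter (λ x → R? x y) xs ] f x y
      ≡⟨ ∑-cong ys (λ {y} _ → ∑-filter (λ x → R? x y) xs (λ x → f x y)) ⟩
    ∑[ y ∈ ys ] ∑[ x ∈ xs ] (if does (R? x y) then f x y else 0)
      ≡⟨ ∑-swap ys xs (λ y x → if does (R? x y) then f x y else 0) ⟩
    ∑[ x ∈ xs ] ∑[ y ∈ ys ] (if does (R? x y) then f x y else 0)
      ≡⟨ ∑-cong xs (λ {x} _ → ∑-filter (R? x) ys (f x)) ⟨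
    ∑[ x ∈ xs ] ∑[ y ∈ filter (R? x) ys ] f x y
      ∎
    where open ≡-Reasoning

  double-counting-≤ : ∀ {R : A → B → Set} (R? : ∀ x y → Dec (R x y)) xs ys c d {w m : A → ℕ} {n : B → ℕ} →
    (∀ {y} → y ∈ ys → c ≤ ∑ (filter (λ x → R? x y) xs) w) →
    (∀ {x} → x ∈ xs → w x * ∑ (filter (R? x) ys) n ≤ d * m x) →
    c * ∑ ys n ≤ d * ∑ xs m
  double-counting-≤ R? xs ys c d {w} {m} {n} covered charged = begin
    c * ∑ ys n
      ≡⟨ *-distribˡ-∑ c ys n ⟩
    ∑[ y ∈ ys ] (c * n y)
      ≤⟨ ∑-mono-≤ ys (λ {y} y∈ → *-monoˡ-≤ (n y) (covered y∈)) ⟩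
    ∑[ y ∈ ys ] (∑ (filter (λ x → R? x y) xs) w * n y)
      ≡⟨ ∑-cong ys (λ {y} _ → *-distribʳ-∑ (n y) (filter (λ x → R? x y) xs) w) ⟩
    ∑[ y ∈ ys ] ∑[ x ∈ filter (λ x → R? x y) xs ] (w x * n y)
      ≡⟨ ∑-filter-swap R? xs ys (λ x y → w x * n y) ⟩
    ∑[ x ∈ xs ] ∑[ y ∈ filter (R? x) ys ] (w x * n y)
      ≡⟨ ∑-cong xs (λ {x} _ → *-distribˡ-∑ (w x) (filter (R? x) ys) n) ⟨
    ∑[ x ∈ xs ] (w x * ∑ (filter (R? x) ys) n)
      ≤⟨ ∑-mono-≤ xs charged ⟩
    ∑[ x ∈ xs ] (d * m x)
      ≡⟨ *-distribˡ-∑ d xs m ⟨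
    d * ∑ xs m
      ∎
    where open ≤-Reasoning

  ∑-injection : ∀ (R : A → B → Set) {f : A → ℕ} {g : B → ℕ} →
                (∀ {x x′ y} → R x y → R x′ y → x ≡ x′) → (∀ {x y} → R x y → f x ≤ g y) →
                ∀ {xs ys} → Unique xs → (∀ {x} → x ∈ xs → ∃ λ y → y ∈ ys × R x y) → ∑ xs f ≤ ∑ ys g
  ∑-injection R injective f≤g []                 image = z≤n
  ∑-injection {B = B} R {f} {g} injective f≤g {x ∷ xs} (x∉ ∷ unique) image with image (here refl)
  ... | y , y∈ys , Rxy with ∈-∃++ y∈ys
  ... | ls , rs , refl = begin
    f x + ∑ xs f           ≤⟨ +-mono-≤ (f≤g Rxy) (∑-injection R injective f≤g unique image-of-rest) ⟩
    g y + ∑ (ls ++ rs) g   ≡⟨ sum-↭ (map⁺ g (shift y ls rs)) ⟨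
    ∑ (ls ++ y ∷ rs) g     ∎
    where
    open ≤-Reasoning
    image-of-rest : ∀ {x′} → x′ ∈ xs → ∃ λ y′ → y′ ∈ ls ++ rs × R x′ y′
    image-of-rest x′∈ with image (there x′∈)
    ... | y′ , y′∈ , Rx′y′ with ∈-resp-↭ (shift y ls rs) y′∈
    ... | here refl   = contradiction (injective Rxy Rx′y′) (All.lookup x∉ x′∈)
    ... | there y′∈′  = y′ , y′∈′ , Rx′y′

  length-injection : ∀ (R : A → B → Set) → (∀ {x x′ y} → R x y → R x′ y → x ≡ x′) →
                     ∀ {xs ys} → Unique xs → (∀ {x} → x ∈ xs → ∃ λ y → y ∈ ys × R x y) → length xs ≤ length ys
  length-injection R injective {xs} {ys} unique image =
    subst₂ _≤_ (∑-1≡length xs) (∑-1≡length ys) (∑-injection R injective (λ _ → ≤-refl) unique image)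

  ∈⇒≤∑ : ∀ {x : A} {xs} (f : A → ℕ) → x ∈ xs → f x ≤ ∑ xs f
  ∈⇒≤∑ {xs = _ ∷ xs} f (here refl) = m≤m+n _ (∑ xs f)
  ∈⇒≤∑ {xs = y ∷ xs} f (there x∈)  = m≤n⇒m≤o+n (f y) (∈⇒≤∑ f x∈)

  ∑-upTo≡∑-downFrom : ∀ n (f : ℕ → ℕ) → ∑ (upTo n) f ≡ ∑ (downFrom n) f
  ∑-upTo≡∑-downFrom n f = trans (sum-↭ (map⁺ f (↭-sym (↭-reverse (upTo n)))))
                                (cong (λ is → ∑ is f) (reverse-upTo n))

module Lists where

  open import Data.List using (List; []; _∷_; _++_; cartesianProduct; concatMap; drop; filter; length; map; take; zip)
  open import Data.List.Membership.Propositional using (_∈_; find; lose)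
  open import Data.List.Membership.Propositional.Properties using (∈-++⁺ˡ; ∈-++⁺ʳ; ∈-concatMap⁺; ∈-concatMap⁻)
  open import Data.List.Properties using (length-++; length-map; filter-++; take++drop≡id)
  open import Data.List.Relation.Binary.Disjoint.Propositional using (Disjoint)
  import Data.List.Relation.Unary.All as All
  import Data.List.Relation.Unary.All.Properties as All
  import Data.List.Relation.Unary.AllPairs as AllPairs
  import Data.List.Relation.Unary.AllPairs.Properties as AllPairs
  open import Data.List.Relation.Unary.Any using (here; there)
  open import Data.List.Relation.Unary.Unique.Propositional using (Unique)
  import Data.List.Relation.Unary.Unique.Propositional.Properties as Unique
  open import Data.Nat using (_+_; _*_; _≤_; z≤n; s≤s)
  open import Data.Nat.Properties using (m≤n⇒m≤1+n)
  open import Data.Product using (∃; _×_; _,_; proj₁; proj₂)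
  open import Data.Sum using (_⊎_; inj₁; inj₂)
  open import Relation.Binary.PropositionalEquality
  open import Relation.Nullary using (Dec; yes; no; contradiction)
  open Summation

  private variable
    A B : Set

  ∈-drop⁻ : ∀ n {x : A} {xs} → x ∈ drop n xs → x ∈ xs
  ∈-drop⁻ n {xs = xs} x∈ = subst (_ ∈_) (take++drop≡id n xs) (∈-++⁺ʳ (take n xs) x∈)

  ∈-take⁻ : ∀ n {x : A} {xs} → x ∈ take n xs → x ∈ xs
  ∈-take⁻ n {xs = xs} x∈ = subst (_ ∈_) (take++drop≡id n xs) (∈-++⁺ˡ x∈)

  ∈-zip⁻ : ∀ (xs : List A) (ys : List B) {p} → p ∈ zip xs ys → proj₁ p ∈ xs × proj₂ p ∈ ys
  ∈-zip⁻ (x ∷ xs) (y ∷ ys) (here refl) = here refl , here refl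
  ∈-zip⁻ (x ∷ xs) (y ∷ ys) (there p∈)  = let x∈ , y∈ = ∈-zip⁻ xs ys p∈ in there x∈ , there y∈

  ∈-zip⊎drop : ∀ {x : A} (xs : List A) (ys : List B) → x ∈ xs →
               (∃ λ y → (x , y) ∈ zip xs ys) ⊎ x ∈ drop (length ys) xs
  ∈-zip⊎drop xs       []       x∈          = inj₂ x∈
  ∈-zip⊎drop (x ∷ xs) (y ∷ ys) (here refl) = inj₁ (y , here refl)
  ∈-zip⊎drop (x ∷ xs) (y ∷ ys) (there x∈) with ∈-zip⊎drop xs ys x∈
  ... | inj₁ (y′ , p∈) = inj₁ (y′ , there p∈)
  ... | inj₂ x∈drop    = inj₂ x∈drop

  map-proj₂-zip : ∀ (xs : List A) (ys : List B) → map proj₂ (zip xs ys) ≡ take (length xs) ys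
  map-proj₂-zip []       ys       = refl
  map-proj₂-zip (x ∷ xs) []       = refl
  map-proj₂-zip (x ∷ xs) (y ∷ ys) = cong (y ∷_) (map-proj₂-zip xs ys)

  length-cartesianProduct : ∀ (xs : List A) (ys : List B) → length (cartesianProduct xs ys) ≡ length xs * length ys
  length-cartesianProduct []       ys = refl
  length-cartesianProduct (x ∷ xs) ys = trans (length-++ (map (x ,_) ys))
    (cong₂ _+_ (length-map (x ,_) ys) (length-cartesianProduct xs ys))

  ∈-concatMap⁻′ : ∀ (f : A → List B) {xs y} → y ∈ concatMap f xs → ∃ λ x → x ∈ xs × y ∈ f x
  ∈-concatMap⁻′ f {xs} y∈ = find (∈-concatMap⁻ f {xs} y∈)

  ∈-concatMap⁺′ : ∀ (f : A → List B) {xs x y} → x ∈ xs → y ∈ f x → y ∈ concatMap f xs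
  ∈-concatMap⁺′ f x∈ y∈ = ∈-concatMap⁺ f (lose x∈ y∈)

  concatMap-unique : ∀ (f : A → List B) (key : B → A) →
                     (∀ x → Unique (f x)) → (∀ {x y} → y ∈ f x → key y ≡ x) →
                     ∀ {xs} → Unique xs → Unique (concatMap f xs)
  concatMap-unique f key unique keyed xs! =
    Unique.concat⁺ (All.map⁺ (All.universal unique _)) (AllPairs.map⁺ (AllPairs.map disjoint xs!))
    where
    disjoint : ∀ {x x′} → x ≢ x′ → Disjoint (f x) (f x′)
    disjoint x≢x′ (y∈ , y∈′) = x≢x′ (trans (sym (keyed y∈)) (keyed y∈′))

  length-concatMap : ∀ (f : A → List B) xs → length (concatMap f xs) ≡ ∑[ x ∈ xs ] length (f x)
  length-concatMap f []       = refl
  length-concatMap f (x ∷ xs) = trans (length-++ (f x)) (cong (length (f x) +_) (length-concatMap f xs))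

  length-filter-++ : ∀ {P : A → Set} (P? : ∀ x → Dec (P x)) xs ys →
                     length (filter P? (xs ++ ys)) ≡ length (filter P? xs) + length (filter P? ys)
  length-filter-++ P? xs ys = trans (cong length (filter-++ P? xs ys)) (length-++ (filter P? xs))

  length-filter-concatMap : ∀ {P : B → Set} (P? : ∀ y → Dec (P y)) (f : A → List B) xs →
                            length (filter P? (concatMap f xs)) ≡ ∑[ x ∈ xs ] length (filter P? (f x))
  length-filter-concatMap P? f []       = refl
  length-filter-concatMap P? f (x ∷ xs) = trans (length-filter-++ P? (f x) (concatMap f xs))
    (cong (length (filter P? (f x)) +_) (length-filter-concatMap P? f xs))

  length-filter-mono-≤ : ∀ {P Q : A → Set} (P? : ∀ x → Dec (P x)) (Q? : ∀ x → Dec (Q x)) xs →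
                         (∀ {x} → x ∈ xs → P x → Q x) → length (filter P? xs) ≤ length (filter Q? xs)
  length-filter-mono-≤ P? Q? []       P⇒Q = z≤n
  length-filter-mono-≤ P? Q? (x ∷ xs) P⇒Q
    with P? x | Q? x | length-filter-mono-≤ P? Q? xs (λ x∈ → P⇒Q (there x∈))
  ... | yes _  | yes _  | rest≤ = s≤s rest≤
  ... | yes Px | no ¬Qx | rest≤ = contradiction (P⇒Q (here refl) Px) ¬Qx
  ... | no _   | yes _  | rest≤ = m≤n⇒m≤1+n rest≤
  ... | no _   | no _   | rest≤ = rest≤

module Arithmetic where

  open import Data.List using (List; map)
  open import Data.List.Extrema.Nat using (max; max≤v⁺; xs≤max)
  open import Data.List.Membership.Propositional using (_∈_)
  open import Data.List.Membership.Propositional.Properties using (∈-map⁺)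
  import Data.List.Relation.Unary.All as All
  import Data.List.Relation.Unary.All.Properties as All
  open import Data.Nat
  open import Data.Nat.DivMod
  open import Data.Nat.Properties
  open import Relation.Binary.PropositionalEquality

  private variable
    A : Set

  ⨆ : List A → (A → ℕ) → ℕ
  ⨆ xs f = max 0 (map f xs)

  ≤-⨆ : ∀ (xs : List A) (f : A → ℕ) {x} → x ∈ xs → f x ≤ ⨆ xs f
  ≤-⨆ xs f x∈ = All.lookup (xs≤max 0 (map f xs)) (∈-map⁺ f x∈)

  ⨆-lub : ∀ (xs : List A) (f : A → ℕ) {b} → (∀ {x} → x ∈ xs → f x ≤ b) → ⨆ xs f ≤ b
  ⨆-lub xs f f≤b = max≤v⁺ z≤n (All.map⁺ (All.tabulate f≤b))

  m∸n≤o⇒m≤n+o : ∀ m n {o} → m ∸ n ≤ o → m ≤ n + o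
  m∸n≤o⇒m≤n+o m n m∸n≤o = ≤-trans (m≤n+m∸n m n) (+-monoʳ-≤ n m∸n≤o)

  m<[1+m/n]*n : ∀ m n .{{_ : NonZero n}} → m < suc (m / n) * n
  m<[1+m/n]*n m n = subst (_< suc (m / n) * n) (sym (m≡m%n+[m/n]*n m n)) (+-monoˡ-< (m / n * n) (m%n<n m n))

  infixl 7 _⌈/⌉_

  _⌈/⌉_ : (m n : ℕ) .{{_ : NonZero n}} → ℕ
  m ⌈/⌉ n = (m + pred n) / n

  m≤m⌈/⌉n*n : ∀ m n .{{_ : NonZero n}} → m ≤ m ⌈/⌉ n * n
  m≤m⌈/⌉n*n m (suc n) = +-cancelʳ-≤ n _ _ (s≤s⁻¹ (begin-strict
    m + n                          <⟨ m<[1+m/n]*n (m + n) (suc n) ⟩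
    suc n + m ⌈/⌉ suc n * suc n    ≡⟨ +-comm (suc n) _ ⟩
    m ⌈/⌉ suc n * suc n + suc n    ≡⟨ +-suc _ n ⟩
    suc (m ⌈/⌉ suc n * suc n + n)  ∎))
    where open ≤-Reasoning

  m⌈/⌉n≢0 : ∀ m n .{{_ : NonZero m}} .{{_ : NonZero n}} → NonZero (m ⌈/⌉ n)
  m⌈/⌉n≢0 m n = m*n≢0⇒m≢0 (m ⌈/⌉ n) {{>-nonZero (<-≤-trans (>-nonZero⁻¹ m) (m≤m⌈/⌉n*n m n))}}

  m⌈/⌉n≤o : ∀ m n {o} .{{_ : NonZero n}} → m ≤ o * n → m ⌈/⌉ n ≤ o
  m⌈/⌉n≤o m (suc n) {o} m≤o*n = s≤s⁻¹ (m<n*o⇒m/o<n {n = suc o} (begin-strict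
    m + n              <⟨ +-mono-≤-< m≤o*n (n<1+n n) ⟩
    o * suc n + suc n  ≡⟨ +-comm (o * suc n) (suc n) ⟩
    suc o * suc n      ∎))
    where open ≤-Reasoning

  m+n⌈/⌉k≤o : ∀ m n k {o} .{{_ : NonZero k}} → k * m + n ≤ k * o → m + n ⌈/⌉ k ≤ o
  m+n⌈/⌉k≤o m n k {o} k*m+n≤k*o = begin
    m + n ⌈/⌉ k    ≤⟨ +-monoʳ-≤ m (m⌈/⌉n≤o n k n≤[o∸m]*k) ⟩
    m + (o ∸ m)    ≡⟨ m+[n∸m]≡n (*-cancelˡ-≤ k (m+n≤o⇒m≤o (k * m) k*m+n≤k*o)) ⟩
    o              ∎
    where
    open ≤-Reasoning
    n≤[o∸m]*k : n ≤ (o ∸ m) * k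
    n≤[o∸m]*k = begin
      n                ≤⟨ m+n≤o⇒m≤o∸n n (subst (_≤ k * o) (+-comm (k * m) n) k*m+n≤k*o) ⟩
      k * o ∸ k * m    ≡⟨ *-distribˡ-∸ k o m ⟨
      k * (o ∸ m)      ≡⟨ *-comm k (o ∸ m) ⟩
      (o ∸ m) * k      ∎

module Harmonic where

  open import Data.List using (downFrom; filter)
  open import Data.List.Membership.Propositional using (_∈_)
  open import Data.List.Membership.Propositional.Properties using (∈-downFrom⁺; ∈-downFrom⁻; ∈-filter⁺)
  import Data.List.Relation.Unary.Unique.Propositional.Properties as Unique
  open import Data.Nat
  open import Data.Nat.DivMod
  open import Data.Nat.Divisibility using (∣-trans; m∣m*n; m≤n⇒m!∣n!)
  open import Data.Nat.Properties
  open import Data.Nat.Tactic.RingSolver using (solve-∀)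
  open import Data.Product using (∃; _×_; _,_)
  open import Relation.Binary.PropositionalEquality
  open import Relation.Nullary using (Dec)
  open import Relation.Nullary.Decidable using (_×-dec_)
  open Summation
  open Arithmetic

  2mn≤m²+n² : ∀ m n → 2 * (m * n) ≤ m * m + n * n
  2mn≤m²+n² zero    n       = z≤n
  2mn≤m²+n² (suc m) zero    = ≤-trans (≤-reflexive (cong (2 *_) (*-zeroʳ m))) z≤n
  2mn≤m²+n² (suc m) (suc n) = begin
    2 * (suc m * suc n)                    ≡⟨ expand-product m n ⟩
    2 * (m * n) + 2 * suc (m + n)          ≤⟨ +-monoˡ-≤ _ (2mn≤m²+n² m n) ⟩
    m * m + n * n + 2 * suc (m + n)        ≡⟨ expand-squares m n ⟨
    suc m * suc m + suc n * suc n          ∎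
    where
    open ≤-Reasoning
    expand-product : ∀ m n → 2 * (suc m * suc n) ≡ 2 * (m * n) + 2 * suc (m + n)
    expand-product = solve-∀
    expand-squares : ∀ m n → suc m * suc m + suc n * suc n ≡ m * m + n * n + 2 * suc (m + n)
    expand-squares = solve-∀

  -- For q = P/x: the tangent (12w - 4x)/9w² to 1/x at x = 3w/2 lies below 1/x.
  reciprocal≥tangent : ∀ w x q → 12 * w * (x * q) ≤ 9 * (w * w) * q + 4 * x * (x * q)
  reciprocal≥tangent w x q = begin
    12 * w * (x * q)                           ≡⟨ factor w x q ⟩
    2 * (3 * w * (2 * x)) * q                  ≤⟨ *-monoˡ-≤ q (2mn≤m²+n² (3 * w) (2 * x)) ⟩
    (3 * w * (3 * w) + 2 * x * (2 * x)) * q    ≡⟨ expand w x q ⟩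
    9 * (w * w) * q + 4 * x * (x * q)          ∎
    where
    open ≤-Reasoning
    factor : ∀ w x q → 12 * w * (x * q) ≡ 2 * (3 * w * (2 * x)) * q
    factor = solve-∀
    expand : ∀ w x q → (3 * w * (3 * w) + 2 * x * (2 * x)) * q ≡ 9 * (w * w) * q + 4 * x * (x * q)
    expand = solve-∀

  ∑-reciprocals≥∑-tangents : ∀ w P (p : ℕ → ℕ) n → (∀ i → i < n → (w + i) * p i ≡ P) →
    12 * w * n * P ≤ 9 * (w * w) * ∑ (downFrom n) p + (4 * w * n + 2 * (n * n)) * P
  ∑-reciprocals≥∑-tangents w P p zero    p≡P/x = ≤-trans (≤-reflexive (cong (_* P) (*-zeroʳ (12 * w)))) z≤n
  ∑-reciprocals≥∑-tangents w P p (suc n) p≡P/x = begin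
    12 * w * suc n * P
      ≡⟨ split w n P ⟩
    12 * w * P + 12 * w * n * P
      ≤⟨ +-mono-≤ last-term (∑-reciprocals≥∑-tangents w P p n λ i i<n → p≡P/x i (m<n⇒m<1+n i<n)) ⟩
    9 * (w * w) * p n + 4 * (w + n) * P + (9 * (w * w) * S + (4 * w * n + 2 * (n * n)) * P)
      ≤⟨ m≤m+n _ (2 * P) ⟩
    9 * (w * w) * p n + 4 * (w + n) * P + (9 * (w * w) * S + (4 * w * n + 2 * (n * n)) * P) + 2 * P
      ≡⟨ collect w n P (p n) S ⟩
    9 * (w * w) * (p n + S) + (4 * w * suc n + 2 * (suc n * suc n)) * P
      ∎
    where
    open ≤-Reasoning
    S : ℕ
    S = ∑ (downFrom n) p
    last-term : 12 * w * P ≤ 9 * (w * w) * p n + 4 * (w + n) * P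
    last-term = subst (λ Q → 12 * w * Q ≤ 9 * (w * w) * p n + 4 * (w + n) * Q) (p≡P/x n ≤-refl)
                  (reciprocal≥tangent w (w + n) (p n))
    split : ∀ w n P → 12 * w * suc n * P ≡ 12 * w * P + 12 * w * n * P
    split = solve-∀
    collect : ∀ w n P q S →
      9 * (w * w) * q + 4 * (w + n) * P + (9 * (w * w) * S + (4 * w * n + 2 * (n * n)) * P) + 2 * P ≡
      9 * (w * w) * (q + S) + (4 * w * suc n + 2 * (suc n * suc n)) * P
    collect = solve-∀

  -- 1/w + … + 1/(2w-1) ≥ 2/3, cleared of denominators.
  2/3≤∑-reciprocals : ∀ w .{{_ : NonZero w}} P (p : ℕ → ℕ) → (∀ i → i < w → (w + i) * p i ≡ P) →
                      2 * P ≤ 3 * ∑ (downFrom w) p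
  2/3≤∑-reciprocals w P p p≡P/x = *-cancelˡ-≤ (3 * (w * w)) {{m*n≢0 3 (w * w) {{_}} {{m*n≢0 w w}}}}
    (+-cancelʳ-≤ (6 * (w * w) * P) _ _ (begin
      3 * (w * w) * (2 * P) + 6 * (w * w) * P               ≡⟨ left w P ⟩
      12 * w * w * P                                        ≤⟨ ∑-reciprocals≥∑-tangents w P p w p≡P/x ⟩
      9 * (w * w) * S + (4 * w * w + 2 * (w * w)) * P       ≡⟨ right w P S ⟩
      3 * (w * w) * (3 * S) + 6 * (w * w) * P               ∎))
    where
    open ≤-Reasoning
    S : ℕ
    S = ∑ (downFrom w) p
    left : ∀ w P → 3 * (w * w) * (2 * P) + 6 * (w * w) * P ≡ 12 * w * w * P
    left = solve-∀
    right : ∀ w P S → 9 * (w * w) * S + (4 * w * w + 2 * (w * w)) * P ≡ 3 * (w * w) * (3 * S) + 6 * (w * w) * P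
    right = solve-∀

  -- The indices x and y stand for the distances x + 1 and y + 1.
  Dyadic : ℕ → ℕ → Set
  Dyadic x y = x ≤ y × y < 2 * suc x

  dyadic? : ∀ x y → Dec (Dyadic x y)
  dyadic? x y = (x ≤? y) ×-dec (y <? 2 * suc x)

  scaledReciprocal : ℕ → ℕ → ℕ
  scaledReciprocal K x = K ! / suc x

  suc*scaledReciprocal : ∀ {K x} → x < K → suc x * scaledReciprocal K x ≡ K !
  suc*scaledReciprocal {K} {x} x<K = m*[n/m]≡n (∣-trans (m∣m*n (x !)) (m≤n⇒m!∣n! x<K))

  ∑-dyadic-reciprocals : ∀ K y → y < K →
    2 * K ! ≤ 3 * ∑ (filter (λ x → dyadic? x y) (downFrom K)) (scaledReciprocal K)
  ∑-dyadic-reciprocals K y y<K = begin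
    2 * K !
      ≤⟨ 2/3≤∑-reciprocals (suc v) (K !) (λ i → scaledReciprocal K (v + i))
           (λ i i<w → suc*scaledReciprocal (v+i<K i<w)) ⟩
    3 * ∑[ i ∈ downFrom (suc v) ] scaledReciprocal K (v + i)
      ≤⟨ *-monoʳ-≤ 3 (∑-injection (λ i x → v + i ≡ x) (λ eq eq′ → +-cancelˡ-≡ v _ _ (trans eq (sym eq′)))
           (λ { refl → ≤-refl }) (Unique.downFrom⁺ (suc v)) v+i-dyadic) ⟩
    3 * ∑ (filter (λ x → dyadic? x y) (downFrom K)) (scaledReciprocal K)
      ∎
    where
    open ≤-Reasoning
    v : ℕ
    v = y / 2
    v+i≤y : ∀ {i} → i < suc v → v + i ≤ y
    v+i≤y {i} i<w = begin
      v + i   ≤⟨ +-monoʳ-≤ v (s≤s⁻¹ i<w) ⟩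
      v + v   ≡⟨ double v ⟩
      v * 2   ≤⟨ m/n*n≤m y 2 ⟩
      y       ∎
      where
      double : ∀ v → v + v ≡ v * 2
      double = solve-∀
    v+i<K : ∀ {i} → i < suc v → v + i < K
    v+i<K i<w = ≤-<-trans (v+i≤y i<w) y<K
    y<2[1+v+i] : ∀ i → y < 2 * suc (v + i)
    y<2[1+v+i] i = begin-strict
      y                  <⟨ m<[1+m/n]*n y 2 ⟩
      suc v * 2          ≡⟨ *-comm (suc v) 2 ⟩
      2 * suc v          ≤⟨ *-monoʳ-≤ 2 (s≤s (m≤m+n v i)) ⟩
      2 * suc (v + i)    ∎
    v+i-dyadic : ∀ {i} → i ∈ downFrom (suc v) → ∃ λ x → x ∈ filter (λ x → dyadic? x y) (downFrom K) × v + i ≡ x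
    v+i-dyadic {i} i∈ = v + i ,
      ∈-filter⁺ (λ x → dyadic? x y) (∈-downFrom⁺ (v+i<K (∈-downFrom⁻ i∈))) (v+i≤y (∈-downFrom⁻ i∈) , y<2[1+v+i] i) ,
      refl

  -- The hypothesis for x is used with weight 1/(x + 1).
  ∑≤3∑-of-dyadic-averages : ∀ K (n μ : ℕ → ℕ) →
    (∀ x → x < K → ∑ (filter (dyadic? x) (downFrom K)) n ≤ μ x * (2 * suc x)) →
    ∑ (downFrom K) n ≤ 3 * ∑ (downFrom K) μ
  ∑≤3∑-of-dyadic-averages K n μ dense = *-cancelˡ-≤ (2 * K !) {{m*n≢0 2 (K !) {{_}} {{K !≢0}}}} (begin
    2 * K ! * ∑ (downFrom K) n
      ≤⟨ double-counting-≤ dyadic? (downFrom K) (downFrom K) (2 * K !) (2 * K ! * 3) covered charged ⟩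
    2 * K ! * 3 * ∑ (downFrom K) μ
      ≡⟨ *-assoc (2 * K !) 3 _ ⟩
    2 * K ! * (3 * ∑ (downFrom K) μ)
      ∎)
    where
    open ≤-Reasoning
    weight : ℕ → ℕ
    weight x = 3 * scaledReciprocal K x

    covered : ∀ {y} → y ∈ downFrom K → 2 * K ! ≤ ∑ (filter (λ x → dyadic? x y) (downFrom K)) weight
    covered {y} y∈ = ≤-trans (∑-dyadic-reciprocals K y (∈-downFrom⁻ y∈))
      (≤-reflexive (*-distribˡ-∑ 3 (filter (λ x → dyadic? x y) (downFrom K)) (scaledReciprocal K)))

    charged : ∀ {x} → x ∈ downFrom K → weight x * ∑ (filter (dyadic? x) (downFrom K)) n ≤ 2 * K ! * 3 * μ x
    charged {x} x∈ = begin
      weight x * ∑ (filter (dyadic? x) (downFrom K)) n  ≤⟨ *-monoʳ-≤ (weight x) (dense x x<K) ⟩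
      weight x * (μ x * (2 * suc x))                    ≡⟨ regroup (scaledReciprocal K x) (μ x) (suc x) ⟩
      2 * (suc x * scaledReciprocal K x) * 3 * μ x      ≡⟨ cong (λ P → 2 * P * 3 * μ x) (suc*scaledReciprocal x<K) ⟩
      2 * K ! * 3 * μ x                                 ∎
      where
      x<K : x < K
      x<K = ∈-downFrom⁻ x∈
      regroup : ∀ a b c → 3 * a * (b * (2 * c)) ≡ 2 * (c * a) * 3 * b
      regroup = solve-∀

module Lindley where

  open import Data.List using (downFrom)
  open import Data.Nat
  open import Data.Nat.Properties
  open import Data.Sum using (inj₁; inj₂)
  open import Relation.Binary.PropositionalEquality
  open Summation

  m+o≤n+p⇒m∸n+o≤p : ∀ m n {o p} → m + o ≤ n + p → o ≤ p → m ∸ n + o ≤ p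
  m+o≤n+p⇒m∸n+o≤p m n {o} {p} m+o≤n+p o≤p with ≤-total m n
  ... | inj₁ m≤n = subst (λ d → d + o ≤ p) (sym (m≤n⇒m∸n≡0 m≤n)) o≤p
  ... | inj₂ n≤m = +-cancelˡ-≤ n _ _ (begin
    n + (m ∸ n + o)  ≡⟨ +-assoc n (m ∸ n) o ⟨
    n + (m ∸ n) + o  ≡⟨ cong (_+ o) (m+[n∸m]≡n n≤m) ⟩
    m + o            ≤⟨ m+o≤n+p ⟩
    n + p            ∎)
    where open ≤-Reasoning

  lindley : ∀ (backlog arrivals service : ℕ → ℕ) D → backlog 0 ≡ 0 →
    (∀ t → backlog (suc t) ≡ backlog t + arrivals t ∸ service t) →
    (∀ z → z ≤ D → ∑[ x ∈ downFrom z ] arrivals (D ∸ suc x) ≤ ∑[ x ∈ downFrom z ] service (D ∸ suc x)) →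
    backlog D ≡ 0
  lindley backlog arrivals service D backlog₀≡0 recursion demand≤capacity =
    n≤0⇒n≡0 (≤-trans (m≤m+n (backlog D) 0) (workload≤capacity D 0 (+-identityʳ D)))
    where
    open ≤-Reasoning
    demand capacity : ℕ → ℕ
    demand z   = ∑[ x ∈ downFrom z ] arrivals (D ∸ suc x)
    capacity z = ∑[ x ∈ downFrom z ] service (D ∸ suc x)

    workload≤capacity : ∀ t z → t + z ≡ D → backlog t + demand z ≤ capacity z
    workload≤capacity zero    z refl rewrite backlog₀≡0 = demand≤capacity z ≤-refl
    workload≤capacity (suc t) z refl = begin
      backlog (suc t) + demand z
        ≡⟨ cong (_+ demand z) (recursion t) ⟩
      backlog t + arrivals t ∸ service t + demand z
        ≤⟨ m+o≤n+p⇒m∸n+o≤p _ (service t) one-step-earlier (demand≤capacity z (m≤n+m z (suc t))) ⟩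
      capacity z
        ∎
      where
      D∸suc[z]≡t : D ∸ suc z ≡ t
      D∸suc[z]≡t = m+n∸n≡m t z
      one-step-earlier : backlog t + arrivals t + demand z ≤ service t + capacity z
      one-step-earlier = subst (λ s → backlog t + arrivals s + demand z ≤ service s + capacity z) D∸suc[z]≡t (begin
        backlog t + arrivals (D ∸ suc z) + demand z   ≡⟨ +-assoc (backlog t) _ (demand z) ⟩
        backlog t + demand (suc z)                    ≤⟨ workload≤capacity t (suc z) (+-suc t z) ⟩
        capacity (suc z)                              ∎)

module EDF where

  open import Data.List
    using (List; []; _∷_; _++_; cartesianProduct; concatMap; downFrom; drop; filter; length; map; upTo; zip)
  open import Data.List.Membership.Propositional using (_∈_)
  open import Data.List.Membership.Propositional.Properties
  open import Data.List.Properties using (length-map; length-upTo; filter-none; filter-accept; filter-reject)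
  open import Data.List.Relation.Binary.Permutation.Propositional using (↭-sym)
  open import Data.List.Relation.Binary.Permutation.Propositional.Properties using (↭-length; filter-↭; ∈-resp-↭)
  import Data.List.Relation.Unary.All as All
  open import Data.List.Relation.Unary.AllPairs using (AllPairs; []; _∷_)
  open import Data.List.Relation.Unary.Any using (here)
  open import Data.List.Relation.Unary.Linked.Properties using (Linked⇒AllPairs)
  open import Data.List.Relation.Unary.Unique.Propositional using (Unique)
  import Data.List.Relation.Unary.Unique.Propositional.Properties as Unique
  import Data.List.Sort as Sort
  open import Data.Nat
  open import Data.Nat.DivMod using (/-monoˡ-≤)
  open import Data.Nat.Properties
  open import Data.Product using (∃; _×_; _,_; proj₁; proj₂)
  open import Data.Sum using (_⊎_; inj₁; inj₂; [_,_])
  import Relation.Binary.Construct.On as On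
  open import Relation.Binary.PropositionalEquality hiding ([_])
  open import Relation.Nullary using (Dec; yes; no; contradiction)
  open import Relation.Nullary.Decidable using (_×-dec_)
  open import Defs using (JobId; CalId)
  open Summation
  open Harmonic
  open Lists
  open Arithmetic
  open Lindley

  record Task : Set where
    field
      dueDate : ℕ
      jobId   : JobId

    releaseDate : ℕ
    releaseDate = proj₁ jobId

  open Task public

  Arrivals : Set
  Arrivals = ℕ → List Task

  seen : Arrivals → ℕ → List Task
  seen a t = concatMap a (downFrom t)

  dueBy? : ∀ D j → Dec (dueDate j ≤ D)
  dueBy? D j = dueDate j ≤? D

  due : ℕ → List Task → ℕ
  due D js = length (filter (dueBy? D) js)

  inWindow? : ∀ b D j → Dec (b ≤ releaseDate j × dueDate j ≤ D)
  inWindow? b D j = (b ≤? releaseDate j) ×-dec dueBy? D j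

  windowCount : ℕ → ℕ → List Task → ℕ
  windowCount b D js = length (filter (inWindow? b D) js)

  -- (b , l) encodes the window [b , b + l + 1).
  density : List Task → ℕ × ℕ → ℕ
  density js (b , l) = windowCount b (suc (b + l)) js ⌈/⌉ suc l

  open Sort (On.decTotalOrder ≤-decTotalOrder dueDate) using (sort; sort-↭; sort-↗)

  -- E bounds all due dates.
  module _ (E : ℕ) where

    windows : List (ℕ × ℕ)
    windows = cartesianProduct (downFrom E) (downFrom E)

    peakDensity : List Task → ℕ
    peakDensity js = ⨆ windows (density js)

    capacity : Arrivals → ℕ → ℕ
    capacity a t = 3 * peakDensity (seen a t)

    opened : Arrivals → ℕ → ℕ
    opened a t = capacity a (suc t) ∸ capacity a t

    machines : Arrivals → ℕ → List CalId
    machines a t = concatMap (λ u → map (u ,_) (upTo (opened a u))) (downFrom t)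

    mutual
      backlog : Arrivals → ℕ → List Task
      backlog a zero    = []
      backlog a (suc t) = drop (capacity a (suc t)) (queue a t)

      queue : Arrivals → ℕ → List Task
      queue a t = sort (backlog a t ++ a t)

    served : Arrivals → ℕ → List (Task × CalId)
    served a t = zip (queue a t) (machines a (suc t))

  AgreeBefore : ℕ → Arrivals → Arrivals → Set
  AgreeBefore t a a′ = ∀ u → u < t → a u ≡ a′ u

  module _ {a a′ : Arrivals} where

    AgreeBefore-pred : ∀ {t} → AgreeBefore (suc t) a a′ → AgreeBefore t a a′
    AgreeBefore-pred eq u u<t = eq u (m<n⇒m<1+n u<t)

    seen-cong : ∀ t → AgreeBefore t a a′ → seen a t ≡ seen a′ t
    seen-cong zero    eq = refl
    seen-cong (suc t) eq = cong₂ _++_ (eq t ≤-refl) (seen-cong t (AgreeBefore-pred eq))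

    module _ (E : ℕ) where

      capacity-cong : ∀ t → AgreeBefore t a a′ → capacity E a t ≡ capacity E a′ t
      capacity-cong t eq = cong (λ js → 3 * peakDensity E js) (seen-cong t eq)

      opened-cong : ∀ t → AgreeBefore (suc t) a a′ → opened E a t ≡ opened E a′ t
      opened-cong t eq = cong₂ _∸_ (capacity-cong (suc t) eq) (capacity-cong t (AgreeBefore-pred eq))

      machines-cong : ∀ t → AgreeBefore t a a′ → machines E a t ≡ machines E a′ t
      machines-cong zero    eq = refl
      machines-cong (suc t) eq = cong₂ _++_ (cong (λ n → map (t ,_) (upTo n)) (opened-cong t eq))
                                            (machines-cong t (AgreeBefore-pred eq))

      queue-cong : ∀ t → AgreeBefore (suc t) a a′ → queue E a t ≡ queue E a′ t
      queue-cong zero    eq = cong sort (eq 0 ≤-refl)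
      queue-cong (suc t) eq = cong₂ (λ js ks → sort (js ++ ks))
        (cong₂ drop (capacity-cong (suc t) (AgreeBefore-pred eq)) (queue-cong t (AgreeBefore-pred eq)))
        (eq (suc t) ≤-refl)

      served-cong : ∀ t → AgreeBefore (suc t) a a′ → served E a t ≡ served E a′ t
      served-cong t eq = cong₂ zip (queue-cong t eq) (machines-cong (suc t) eq)

  ∈⇒due>0 : ∀ {D j js} → j ∈ js → dueDate j ≤ D → 0 < due D js
  ∈⇒due>0 {D} j∈ j≤D = ∈-length (∈-filter⁺ (dueBy? D) j∈ j≤D)

  EarliestDueFirst : List Task → Set
  EarliestDueFirst = AllPairs (λ i j → dueDate i ≤ dueDate j)

  sort-earliestDueFirst : ∀ js → EarliestDueFirst (sort js)
  sort-earliestDueFirst js = Linked⇒AllPairs ≤-trans (sort-↗ js)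

  due-drop : ∀ D n {js} → EarliestDueFirst js → due D (drop n js) ≡ due D js ∸ n
  due-drop D zero    _  = refl
  due-drop D (suc n) [] = refl
  due-drop D (suc n) {j ∷ js} (j≤js ∷ sorted) with dueDate j ≤? D
  ... | yes j≤D = trans (due-drop D n sorted) (cong (λ ks → length ks ∸ suc n) (sym (filter-accept (dueBy? D) j≤D)))
  ... | no  j≰D = begin
    due D (drop n js)        ≡⟨ due-drop D n sorted ⟩
    due D js ∸ n             ≡⟨ cong (_∸ n) none-due ⟩
    0 ∸ n                    ≡⟨ 0∸n≡0 n ⟩
    0 ∸ suc n                ≡⟨ cong (_∸ suc n) none-due ⟨
    due D js ∸ suc n         ≡⟨ cong (λ ks → length ks ∸ suc n) (filter-reject (dueBy? D) j≰D) ⟨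
    due D (j ∷ js) ∸ suc n   ∎
    where
    open ≡-Reasoning
    none-due : due D js ≡ 0
    none-due = cong length (filter-none (dueBy? D) (All.map (λ j≤k k≤D → j≰D (≤-trans j≤k k≤D)) j≤js))

  module _ (E : ℕ) where

    windowCount≤peakDensity : ∀ js {b D} → b < D → D ≤ E → windowCount b D js ≤ peakDensity E js * (D ∸ b)
    windowCount≤peakDensity js {b} b<D D≤E with m≤n⇒∃[o]m+o≡n b<D
    ... | l , refl = begin
      windowCount b (suc (b + l)) js         ≤⟨ m≤m⌈/⌉n*n _ (suc l) ⟩
      density js (b , l) * suc l             ≤⟨ *-monoˡ-≤ (suc l) (≤-⨆ (windows E) (density js) window∈) ⟩
      peakDensity E js * suc l               ≡⟨ cong (peakDensity E js *_) (m+n∸m≡n b (suc l)) ⟨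
      peakDensity E js * (b + suc l ∸ b)     ≡⟨ cong (λ D → peakDensity E js * (D ∸ b)) (+-suc b l) ⟩
      peakDensity E js * (suc (b + l) ∸ b)   ∎
      where
      open ≤-Reasoning
      window∈ : (b , l) ∈ windows E
      window∈ = ∈-cartesianProduct⁺ (∈-downFrom⁺ (≤-trans (s≤s (m≤m+n b l)) D≤E))
                                    (∈-downFrom⁺ (≤-trans (s≤s (m≤n+m l b)) D≤E))

    peakDensity-lub : ∀ js m → (∀ b l → windowCount b (suc (b + l)) js ≤ m * suc l) → peakDensity E js ≤ m
    peakDensity-lub js m count≤ = ⨆-lub (windows E) (density js) λ { {b , l} _ → m⌈/⌉n≤o _ (suc l) (count≤ b l) }

    peakDensity-++-≤ : ∀ js ks → peakDensity E ks ≤ peakDensity E (js ++ ks)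
    peakDensity-++-≤ js ks = ⨆-lub (windows E) (density ks) λ w∈ →
      ≤-trans (density-++-≤ _) (≤-⨆ (windows E) (density (js ++ ks)) w∈)
      where
      density-++-≤ : ∀ w → density ks w ≤ density (js ++ ks) w
      density-++-≤ (b , l) = /-monoˡ-≤ (suc l) (+-monoˡ-≤ l (subst (windowCount b D ks ≤_)
        (sym (length-filter-++ (inWindow? b D) js ks)) (m≤n+m (windowCount b D ks) (windowCount b D js))))
        where
        D : ℕ
        D = suc (b + l)

    capacity-zero : ∀ a → capacity E a 0 ≡ 0
    capacity-zero a = cong (3 *_) (n≤0⇒n≡0 (peakDensity-lub [] 0 λ b l → z≤n))

    capacity-mono : ∀ a t → capacity E a t ≤ capacity E a (suc t)
    capacity-mono a t = *-monoʳ-≤ 3 (peakDensity-++-≤ (a t) (seen a t))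

    ∑-opened≡capacity : ∀ a t → ∑ (downFrom t) (opened E a) ≡ capacity E a t
    ∑-opened≡capacity a zero    = sym (capacity-zero a)
    ∑-opened≡capacity a (suc t) = trans (cong (opened E a t +_) (∑-opened≡capacity a t))
                                        (m∸n+n≡m (capacity-mono a t))

    opened>0⇒arrival : ∀ a t {k} → k < opened E a t → ∃ λ j → j ∈ a t
    opened>0⇒arrival a t k< with a t
    ... | j ∷ _ = j , here refl
    ... | []    = contradiction (n∸n≡0 (capacity E a t)) (>⇒≢ (≤-<-trans z≤n k<))

    length-machines : ∀ a t → length (machines E a t) ≡ capacity E a t
    length-machines a t = trans (length-concatMap _ (downFrom t)) (trans
      (∑-cong (downFrom t) λ {u} _ → trans (length-map (u ,_) (upTo (opened E a u))) (length-upTo (opened E a u)))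
      (∑-opened≡capacity a t))

    ∈-machines⁻ : ∀ a t {c} → c ∈ machines E a t → proj₁ c < t × proj₂ c < opened E a (proj₁ c)
    ∈-machines⁻ a t c∈ with ∈-concatMap⁻′ (λ u → map (u ,_) (upTo (opened E a u))) c∈
    ... | u , u∈ , c∈u with ∈-map⁻ (u ,_) c∈u
    ... | k , k∈ , refl = ∈-downFrom⁻ u∈ , ∈-upTo⁻ k∈

    machines-unique : ∀ a t → Unique (machines E a t)
    machines-unique a t = concatMap-unique _ proj₁
      (λ u → Unique.map⁺ (cong proj₂) (Unique.upTo⁺ _)) started-at (Unique.downFrom⁺ t)
      where
      started-at : ∀ {u c} → c ∈ map (u ,_) (upTo (opened E a u)) → proj₁ c ≡ u
      started-at c∈ with ∈-map⁻ (_ ,_) c∈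
      ... | k , _ , refl = refl

    due-backlog-suc : ∀ D a t →
      due D (backlog E a (suc t)) ≡ due D (backlog E a t) + due D (a t) ∸ capacity E a (suc t)
    due-backlog-suc D a t = begin
      due D (drop (capacity E a (suc t)) (queue E a t))
        ≡⟨ due-drop D (capacity E a (suc t)) (sort-earliestDueFirst (backlog E a t ++ a t)) ⟩
      due D (queue E a t) ∸ capacity E a (suc t)
        ≡⟨ cong (_∸ capacity E a (suc t)) (↭-length (filter-↭ (dueBy? D) (sort-↭ (backlog E a t ++ a t)))) ⟩
      due D (backlog E a t ++ a t) ∸ capacity E a (suc t)
        ≡⟨ cong (_∸ capacity E a (suc t)) (length-filter-++ (dueBy? D) (backlog E a t) (a t)) ⟩
      due D (backlog E a t) + due D (a t) ∸ capacity E a (suc t)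
        ∎
      where open ≡-Reasoning

    Admissible : Arrivals → Set
    Admissible a = ∀ t {j} → j ∈ a t → releaseDate j ≡ t × t < dueDate j × dueDate j ≤ E

    module _ {a : Arrivals} (admissible : Admissible a) where

      due≤windowCount : ∀ {b} D u → b ≤ u → due D (a u) ≤ windowCount b D (a u)
      due≤windowCount {b} D u b≤u = length-filter-mono-≤ (dueBy? D) (inWindow? b D) (a u) λ j∈ j≤D →
        subst (b ≤_) (sym (proj₁ (admissible u j∈))) b≤u , j≤D

      ∑-due≤windowCount : ∀ D x {z} → z ≤ D →
        ∑[ y ∈ filter (dyadic? x) (downFrom z) ] due D (a (D ∸ suc y)) ≤
        windowCount (D ∸ 2 * suc x) D (seen a (suc (D ∸ suc x)))
      ∑-due≤windowCount D x {z} z≤D = ≤-trans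
        (∑-injection AtDistance same-distance due≤ (Unique.filter⁺ (dyadic? x) (Unique.downFrom⁺ z)) release-time)
        (≤-reflexive (sym (length-filter-concatMap (inWindow? b D) a (downFrom (suc u)))))
        where
        b u : ℕ
        b = D ∸ 2 * suc x
        u = D ∸ suc x
        AtDistance : ℕ → ℕ → Set
        AtDistance y v = suc y + v ≡ D × b ≤ v
        same-distance : ∀ {y y′ v} → AtDistance y v → AtDistance y′ v → y ≡ y′
        same-distance {v = v} (eq , _) (eq′ , _) = suc-injective (+-cancelʳ-≡ v _ _ (trans eq (sym eq′)))
        due≤ : ∀ {y v} → AtDistance y v → due D (a (D ∸ suc y)) ≤ windowCount b D (a v)
        due≤ {y} {v} (refl , b≤v) = subst (λ w → due D (a w) ≤ windowCount b D (a v)) (sym (m+n∸m≡n (suc y) v))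
                                      (due≤windowCount D v b≤v)
        release-time : ∀ {y} → y ∈ filter (dyadic? x) (downFrom z) → ∃ λ v → v ∈ downFrom (suc u) × AtDistance y v
        release-time {y} y∈ with ∈-filter⁻ (dyadic? x) {xs = downFrom z} y∈
        ... | y∈z , x≤y , y<2[1+x] = D ∸ suc y ,
          ∈-downFrom⁺ (s≤s (∸-monoʳ-≤ D (s≤s x≤y))) ,
          m+[n∸m]≡n (≤-trans (∈-downFrom⁻ y∈z) z≤D) , ∸-monoʳ-≤ D y<2[1+x]

      demand≤capacity : ∀ D → D ≤ E → ∀ z → z ≤ D →
        ∑[ x ∈ downFrom z ] due D (a (D ∸ suc x)) ≤ ∑[ x ∈ downFrom z ] capacity E a (suc (D ∸ suc x))
      demand≤capacity D D≤E z z≤D =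
        ≤-trans (∑≤3∑-of-dyadic-averages z _ peak dense) (≤-reflexive (*-distribˡ-∑ 3 (downFrom z) _))
        where
        open ≤-Reasoning
        peak : ℕ → ℕ
        peak x = peakDensity E (seen a (suc (D ∸ suc x)))
        dense : ∀ x → x < z → ∑[ y ∈ filter (dyadic? x) (downFrom z) ] due D (a (D ∸ suc y)) ≤ peak x * (2 * suc x)
        dense x x<z = begin
          ∑[ y ∈ filter (dyadic? x) (downFrom z) ] due D (a (D ∸ suc y))
            ≤⟨ ∑-due≤windowCount D x z≤D ⟩
          windowCount (D ∸ 2 * suc x) D (seen a (suc (D ∸ suc x)))
            ≤⟨ windowCount≤peakDensity (seen a (suc (D ∸ suc x))) window-start<D D≤E ⟩
          peak x * (D ∸ (D ∸ 2 * suc x))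
            ≤⟨ *-monoʳ-≤ (peak x) window-length≤ ⟩
          peak x * (2 * suc x)
            ∎
          where
          window-length≤ : D ∸ (D ∸ 2 * suc x) ≤ 2 * suc x
          window-length≤ = m≤n+o⇒m∸n≤o D (D ∸ 2 * suc x)
            (≤-trans (m≤n+m∸n D (2 * suc x)) (≤-reflexive (+-comm (2 * suc x) _)))
          window-start<D : D ∸ 2 * suc x < D
          window-start<D = ≤-<-trans (∸-monoʳ-≤ D (m≤m+n (suc x) _)) (∸-monoʳ-< z<s (≤-trans x<z z≤D))

      no-overdue-backlog : ∀ D → D ≤ E → due D (backlog E a D) ≡ 0
      no-overdue-backlog D D≤E =
        lindley (λ t → due D (backlog E a t)) (λ t → due D (a t)) (λ t → capacity E a (suc t)) D
          refl (due-backlog-suc D a) (demand≤capacity D D≤E)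

      ∈-queue⁻ : ∀ t {j} → j ∈ queue E a t → j ∈ backlog E a t ⊎ j ∈ a t
      ∈-queue⁻ t j∈ = ∈-++⁻ (backlog E a t) (∈-resp-↭ (sort-↭ (backlog E a t ++ a t)) j∈)

      ∈-queue⁺ : ∀ t {j} → j ∈ backlog E a t ⊎ j ∈ a t → j ∈ queue E a t
      ∈-queue⁺ t j∈ = ∈-resp-↭ (↭-sym (sort-↭ (backlog E a t ++ a t)))
                        ([ ∈-++⁺ˡ , ∈-++⁺ʳ (backlog E a t) ] j∈)

      queue-arrived : ∀ t {j} → j ∈ queue E a t → ∃ λ u → u ≤ t × j ∈ a u
      queue-arrived t j∈ with ∈-queue⁻ t j∈
      queue-arrived t       j∈ | inj₂ j∈a       = t , ≤-refl , j∈a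
      queue-arrived (suc t) j∈ | inj₁ j∈backlog =
        let u , u≤t , j∈a = queue-arrived t (∈-drop⁻ (capacity E a (suc t)) j∈backlog) in u , m≤n⇒m≤1+n u≤t , j∈a

      queue-not-overdue : ∀ t {j} → j ∈ queue E a t → t < dueDate j × dueDate j ≤ E
      queue-not-overdue t j∈ with ∈-queue⁻ t j∈
      queue-not-overdue t           j∈ | inj₂ j∈a       = proj₂ (admissible t j∈a)
      queue-not-overdue (suc t) {j} j∈ | inj₁ j∈backlog
        with queue-not-overdue t (∈-drop⁻ (capacity E a (suc t)) j∈backlog) | suc t <? dueDate j
      ... | t<d , d≤E | yes 1+t<d = 1+t<d , d≤E
      ... | t<d , d≤E | no  1+t≮d = contradiction (no-overdue-backlog (suc t) (≤-trans t<d d≤E))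
                                                  (>⇒≢ (∈⇒due>0 j∈backlog (≮⇒≥ 1+t≮d)))

      ServedFrom : ℕ → Task → Set
      ServedFrom u j = ∃ λ t → u ≤ t × ∃ λ c → (j , c) ∈ served E a t

      served⊎backlog : ∀ t {j} → j ∈ queue E a t → ServedFrom t j ⊎ j ∈ backlog E a (suc t)
      served⊎backlog t {j} j∈ with ∈-zip⊎drop (queue E a t) (machines E a (suc t)) j∈
      ... | inj₁ (c , jc∈) = inj₁ (t , ≤-refl , c , jc∈)
      ... | inj₂ j∈drop    = inj₂ (subst (λ n → j ∈ drop n (queue E a t)) (length-machines a (suc t)) j∈drop)

      served⊎waiting : ∀ {u} t {j} → j ∈ a u → u < t → ServedFrom u j ⊎ j ∈ backlog E a t
      served⊎waiting {u} (suc t) j∈ u<1+t with m<1+n⇒m<n∨m≡n u<1+t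
      ... | inj₂ refl = served⊎backlog t (∈-queue⁺ t (inj₂ j∈))
      ... | inj₁ u<t with served⊎waiting t j∈ u<t
      ...   | inj₁ done      = inj₁ done
      ...   | inj₂ j∈backlog with served⊎backlog t (∈-queue⁺ t (inj₁ j∈backlog))
      ...     | inj₁ (v , t≤v , done) = inj₁ (v , ≤-trans (<⇒≤ u<t) t≤v , done)
      ...     | inj₂ j∈backlog′       = inj₂ j∈backlog′

      eventually-served : ∀ u {j} → j ∈ a u → ServedFrom u j
      eventually-served u {j} j∈ with admissible u j∈
      ... | _ , u<d , d≤E with served⊎waiting (dueDate j) j∈ u<d
      ... | inj₁ done      = done
      ... | inj₂ j∈backlog = contradiction (no-overdue-backlog (dueDate j) d≤E) (>⇒≢ (∈⇒due>0 j∈backlog ≤-refl))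

module Blocks where

  open import Data.Fin using (Fin; toℕ; fromℕ<)
  open import Data.Fin.Properties using (toℕ<n; toℕ-injective; toℕ-fromℕ<)
  open import Data.List using (List; []; allFin; concatMap; filter; length; lookup; map; take; upTo)
  open import Data.List.Membership.Propositional using (_∈_)
  open import Data.List.Membership.Propositional.Properties
  open import Data.List.Properties using (concatMap-cong; map-concatMap; map-∘)
  import Data.List.Relation.Unary.All as All
  open import Data.List.Relation.Unary.Unique.Propositional using (Unique)
  import Data.List.Relation.Unary.Unique.Propositional.Properties as Unique
  open import Data.Nat
  open import Data.Nat.DivMod
  open import Data.Nat.Properties
  open import Algebra.Properties.CommutativeSemigroup +-commutativeSemigroup using (xy∙z≈xz∙y)
  open import Data.Nat.Tactic.RingSolver using (solve-∀)
  open import Data.Product using (Σ; ∃; _×_; _,_; proj₁; proj₂)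
  open import Data.Vec as Vec using (Vec)
  open import Data.Vec.Properties using (lookup∘tabulate)
  open import Relation.Binary.PropositionalEquality
  open import Relation.Nullary using (Dec; yes; no; contradiction)
  open import Defs
  open Lists
  open Arithmetic
  open EDF

  padded : ∀ {n} → Vec (List ℕ) n → ℕ → List ℕ
  padded {n} v u with u <? n
  ... | yes u<n = Vec.lookup v (fromℕ< u<n)
  ... | no  _   = []

  padded-history : ∀ I {t u} → u ≤ t → padded (history I t) u ≡ arr I u
  padded-history I {t} {u} u≤t with u <? suc t
  ... | yes u<1+t = trans (lookup∘tabulate (λ i → arr I (toℕ i)) (fromℕ< u<1+t))
                          (cong (arr I) (toℕ-fromℕ< u<1+t))
  ... | no  u≮1+t = contradiction (s≤s u≤t) u≮1+t

  ShortWindows : (T lam L : ℕ) → Instance → Set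
  ShortWindows T lam L I = ∀ j → deadline I j + L ≤ release I j + lam + T

  module BlockwiseEDF (T lam L : ℕ) {{L≢0 : NonZero L}} where

    -- The schedule of a block is planned in time shifted by lam: what EDF does at time t is
    -- executed at time t + lam, when the machines opened up to time t are calibrated.
    task : ∀ u (ds : List ℕ) → Fin (length ds) → Task
    task u ds f = record { dueDate = lookup ds f ∸ lam ; jobId = u , toℕ f }

    tasks : ℕ → List ℕ → List Task
    tasks u ds = map (task u ds) (allFin (length ds))

    inBlock? : ∀ i j → Dec (releaseDate j / L ≡ i)
    inBlock? i j = releaseDate j / L ≟ i

    block : (ℕ → List ℕ) → ℕ → Arrivals
    block h i u = filter (inBlock? i) (tasks u (h u))

    blockEnd : ℕ → ℕ
    blockEnd i = i * L + T

    assign : Task × CalId → JobId × CalId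
    assign (j , c) = jobId j , c

    blockRuns : (ℕ → List ℕ) → ℕ → ℕ → List (JobId × CalId)
    blockRuns h t i = map assign (served (blockEnd i) (block h i) t)

    -- The truncated subtraction makes the list of blocks empty for t < lam.
    algorithm : OnlineAlg
    algorithm t v = record
      { calibs = opened (blockEnd (t / L)) (block (padded v) (t / L)) t
      ; runs   = concatMap (blockRuns (padded v) (t ∸ lam)) (upTo (suc t ∸ lam))
      }

    ∈-block⁻ : ∀ h {i} u {j} → j ∈ block h i u → u / L ≡ i × ∃ λ f → j ≡ task u (h u) f
    ∈-block⁻ h {i} u j∈ with ∈-filter⁻ (inBlock? i) {xs = tasks u (h u)} j∈
    ... | j∈tasks , u/L≡i with ∈-map⁻ (task u (h u)) j∈tasks
    ... | f , _ , refl = u/L≡i , f , refl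

    ∈-block⁺ : ∀ h u f → task u (h u) f ∈ block h (u / L) u
    ∈-block⁺ h u f = ∈-filter⁺ (inBlock? (u / L)) (∈-map⁺ (task u (h u)) (∈-allFin f)) refl

    module _ (I : Instance) where

      arrivals : ℕ → Arrivals
      arrivals = block (arr I)

      blockQueue : ℕ → ℕ → List Task
      blockQueue i = queue (blockEnd i) (arrivals i)

      blockMachines : ℕ → ℕ → List CalId
      blockMachines i t = machines (blockEnd i) (arrivals i) (suc t)

      history-agrees : ∀ {t x} i → x ≤ t → AgreeBefore (suc x) (block (padded (history I t)) i) (arrivals i)
      history-agrees i x≤t u u<1+x = cong (λ ds → filter (inBlock? i) (tasks u ds))
        (padded-history I (≤-trans (s≤s⁻¹ u<1+x) x≤t))

      calibs≡opened : ∀ t → calibs (dec algorithm I t) ≡ opened (blockEnd (t / L)) (arrivals (t / L)) t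
      calibs≡opened t = opened-cong (blockEnd (t / L)) t (history-agrees (t / L) ≤-refl)

      runs≡ : ∀ t → runs (dec algorithm I t) ≡ concatMap (blockRuns (arr I) (t ∸ lam)) (upTo (suc t ∸ lam))
      runs≡ t = concatMap-cong
        (λ i → cong (map assign) (served-cong (blockEnd i) (t ∸ lam) (history-agrees i (m∸n≤m t lam))))
        (upTo (suc t ∸ lam))

      Served : ℕ → ℕ → Task × CalId → Set
      Served i x p = p ∈ served (blockEnd i) (arrivals i) x

      ∈-runs⁻ : ∀ t {r} → r ∈ runs (dec algorithm I t) →
                ∃ λ i → ∃ λ x → ∃ λ p → t ≡ x + lam × Served i x p × r ≡ assign p
      ∈-runs⁻ t {r} r∈
        with ∈-concatMap⁻′ (blockRuns (arr I) (t ∸ lam)) {upTo (suc t ∸ lam)} (subst (r ∈_) (runs≡ t) r∈)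
      ... | i , i∈ , r∈i with ∈-map⁻ assign r∈i
      ... | p , p∈ , r≡ = i , t ∸ lam , p , sym (m∸n+n≡m lam≤t) , p∈ , r≡
        where
        lam≤t : lam ≤ t
        lam≤t = s≤s⁻¹ (m∸n≢0⇒n<m (>⇒≢ (≤-<-trans z≤n (∈-upTo⁻ i∈))))

      ∈-runs⁺ : ∀ {i x p} → i ≤ x → Served i x p → assign p ∈ runs (dec algorithm I (x + lam))
      ∈-runs⁺ {i} {x} {p} i≤x p∈ = subst (assign p ∈_) (sym (runs≡ (x + lam)))
        (∈-concatMap⁺′ (blockRuns (arr I) (x + lam ∸ lam))
          (∈-upTo⁺ (subst (i <_) (sym (m+n∸n≡m (suc x) lam)) (s≤s i≤x)))
          (subst (λ x → assign p ∈ blockRuns (arr I) x i) (sym (m+n∸n≡m x lam)) (∈-map⁺ assign p∈)))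

      ∈-blockMachines⇒block : ∀ i x {c} → c ∈ blockMachines i x → proj₁ c / L ≡ i
      ∈-blockMachines⇒block i x c∈ =
        let _ , k<      = ∈-machines⁻ (blockEnd i) (arrivals i) (suc x) c∈
            _ , j∈      = opened>0⇒arrival (blockEnd i) (arrivals i) _ k<
            u/L≡i , _   = ∈-block⁻ (arr I) _ j∈
        in u/L≡i

      runs-unique : ∀ t → Unique (map proj₂ (runs (dec algorithm I t)))
      runs-unique t = subst Unique
        (sym (trans (cong (map proj₂) (runs≡ t)) (map-concatMap proj₂ (blockRuns (arr I) x) (upTo (suc t ∸ lam)))))
        (concatMap-unique (λ i → map proj₂ (blockRuns (arr I) x i)) (λ c → proj₁ c / L) unique same-block
          (Unique.upTo⁺ (suc t ∸ lam)))
        where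
        x : ℕ
        x = t ∸ lam
        used-machines : ∀ i → map proj₂ (blockRuns (arr I) x i) ≡ take (length (blockQueue i x)) (blockMachines i x)
        used-machines i = trans (sym (map-∘ (served (blockEnd i) (arrivals i) x)))
          (map-proj₂-zip (blockQueue i x) (blockMachines i x))
        unique : ∀ i → Unique (map proj₂ (blockRuns (arr I) x i))
        unique i = subst Unique (sym (used-machines i))
          (Unique.take⁺ _ (machines-unique (blockEnd i) (arrivals i) (suc x)))
        same-block : ∀ {i c} → c ∈ map proj₂ (blockRuns (arr I) x i) → proj₁ c / L ≡ i
        same-block {i} {c} c∈ = ∈-blockMachines⇒block i x (∈-take⁻ _ (subst (c ∈_) (used-machines i) c∈))

      machine⇒calibrated : ∀ i x {c} → c ∈ blockMachines i x → x < blockEnd i →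
                           CalibratedAt T lam algorithm I c (x + lam)
      machine⇒calibrated i x {u , k} c∈ x<E =
        let u<1+x , k< = ∈-machines⁻ (blockEnd i) (arrivals i) (suc x) c∈
            i≡u/L      = sym (∈-blockMachines⇒block i x c∈)
        in subst (k <_) (sym (calibs≡opened u)) (subst (λ i → k < opened (blockEnd i) (arrivals i) u) i≡u/L k<) ,
           +-monoˡ-≤ lam (s≤s⁻¹ u<1+x) ,
           calibration-covers (subst (λ i → x < blockEnd i) i≡u/L x<E)
        where
        open ≤-Reasoning
        calibration-covers : x < blockEnd (u / L) → x + lam < u + lam + T
        calibration-covers x<E = begin-strict
          x + lam              <⟨ +-monoˡ-< lam x<E ⟩
          u / L * L + T + lam  ≤⟨ +-monoˡ-≤ lam (+-monoˡ-≤ T (m/n*n≤m u L)) ⟩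
          u + T + lam          ≡⟨ xy∙z≈xz∙y u T lam ⟩
          u + lam + T          ∎

      InTime : ℕ → JobId → Set
      InTime t (u , n) = Σ (n < length (arr I u)) λ _ →
        u ≤ t × (∀ (f : Fin (length (arr I u))) → toℕ f ≡ n → suc t ≤ lookup (arr I u) f)

      module _ (wf : WellFormed lam I) (short : ShortWindows T lam L I) where

        dueDate≤blockEnd : ∀ u f → lookup (arr I u) f ∸ lam ≤ blockEnd (u / L)
        dueDate≤blockEnd u f = m≤n+o⇒m∸n≤o _ lam (+-cancelʳ-≤ L _ _ (begin
          lookup (arr I u) f + L       ≤⟨ short (u , f) ⟩
          u + lam + T                  ≡⟨ +-assoc u lam T ⟩
          u + (lam + T)                ≤⟨ +-monoˡ-≤ (lam + T) (<⇒≤ (m<[1+m/n]*n u L)) ⟩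
          L + u / L * L + (lam + T)    ≡⟨ rearrange L (u / L * L) lam T ⟩
          lam + blockEnd (u / L) + L   ∎))
          where
          open ≤-Reasoning
          rearrange : ∀ L b l T → L + b + (l + T) ≡ l + (b + T) + L
          rearrange = solve-∀

        arrivals-admissible : ∀ i → Admissible (blockEnd i) (arrivals i)
        arrivals-admissible i u j∈ with ∈-block⁻ (arr I) u j∈
        ... | refl , f , refl = refl ,
          m+n≤o⇒m≤o∸n (suc u) (subst (_≤ lookup (arr I u) f) (+-suc u lam) (wf (u , f))) ,
          dueDate≤blockEnd u f

        queued⇒in-time : ∀ i x {j} → j ∈ blockQueue i x → InTime (x + lam) (jobId j)
        queued⇒in-time i x j∈ with queue-arrived (blockEnd i) (arrivals-admissible i) x j∈
        ... | u , u≤x , j∈a with ∈-block⁻ (arr I) u j∈a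
        ... | _ , f , refl = toℕ<n f , m≤n⇒m≤n+o lam u≤x , before-deadline
          where
          lam≤deadline : lam ≤ lookup (arr I u) f
          lam≤deadline = m+n≤o⇒n≤o (suc u) (subst (_≤ lookup (arr I u) f) (+-suc u lam) (wf (u , f)))
          before-deadline : ∀ f′ → toℕ f′ ≡ toℕ f → suc (x + lam) ≤ lookup (arr I u) f′
          before-deadline f′ eq rewrite toℕ-injective eq = m≤o∸n⇒m+n≤o (suc x) lam≤deadline
            (proj₁ (queue-not-overdue (blockEnd i) (arrivals-admissible i) x j∈))

        served⇒legal : ∀ {i x p} → Served i x p → LegalRun T lam algorithm I (x + lam) (assign p)
        served⇒legal {i} {x} p∈ =
          let j∈ , c∈                    = ∈-zip⁻ (blockQueue i x) (blockMachines i x) p∈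
              x<d , d≤E                  = queue-not-overdue (blockEnd i) (arrivals-admissible i) x j∈
              n< , released , unexpired  = queued⇒in-time i x j∈
          in n< , released , unexpired , machine⇒calibrated i x c∈ (<-≤-trans x<d d≤E)

        runs-legal : ∀ t {r} → r ∈ runs (dec algorithm I t) → LegalRun T lam algorithm I t r
        runs-legal t r∈ =
          let _ , _ , _ , t≡ , p∈ , r≡ = ∈-runs⁻ t r∈
          in subst₂ (LegalRun T lam algorithm I) (sym t≡) (sym r≡) (served⇒legal p∈)

        all-jobs-run : ∀ (j : Job I) → ∃ λ t → ∃ λ c → ((proj₁ j , toℕ (proj₂ j)) , c) ∈ runs (dec algorithm I t)
        all-jobs-run (u , f) =
          let x , u≤x , c , p∈ = eventually-served (blockEnd (u / L)) (arrivals-admissible (u / L)) u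
                                   (∈-block⁺ (arr I) u f)
          in x + lam , c , ∈-runs⁺ (≤-trans (m/n≤m u L) u≤x) p∈

        feasible : Feasible T lam algorithm I
        feasible = (λ t → All.tabulate (runs-legal t)) , runs-unique , all-jobs-run

module Cost where

  open import Data.Fin using (Fin)
  open import Data.Fin.Properties using (toℕ-injective)
  open import Data.List using (List; allFin; applyUpTo; cartesianProduct; downFrom; filter; length; lookup; upTo)
  open import Data.List.Membership.Propositional using (_∈_)
  open import Data.List.Membership.Propositional.Properties
  open import Data.List.Properties using (length-applyUpTo; length-tabulate; length-upTo)
  open import Data.List.Relation.Unary.Unique.Propositional using (Unique)
  import Data.List.Relation.Unary.Unique.Propositional.Properties as Unique
  open import Data.Nat
  open import Data.Nat.DivMod
  open import Data.Nat.Properties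
  open import Algebra.Properties.CommutativeSemigroup +-commutativeSemigroup using (xy∙z≈xz∙y)
  open import Data.Nat.Tactic.RingSolver using (solve-∀)
  open import Data.Product using (∃; _×_; _,_; proj₁; proj₂)
  open import Data.Sum using (inj₁; inj₂)
  open import Function using (id)
  open import Relation.Binary.PropositionalEquality
  open import Relation.Nullary using (Dec)
  open import Relation.Nullary.Decidable using (_×-dec_)
  open import Defs
  open Summation
  open Lists
  open Arithmetic
  open EDF
  open Blocks

  module _ (T L : ℕ) where

    MeetsBlock : ℕ → ℕ → Set
    MeetsBlock i u = i * L < u + T × u < i * L + T

    meetsBlock? : ∀ i u → Dec (MeetsBlock i u)
    meetsBlock? i u = (i * L <? u + T) ×-dec (u <? i * L + T)

    blocks-met≤ : .{{_ : NonZero L}} → ∀ k → 2 * T ≤ L * k →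
                  ∀ N u → length (filter (λ i → meetsBlock? i u) (upTo N)) ≤ k
    blocks-met≤ k 2T≤Lk N u = subst (length (filter (λ i → meetsBlock? i u) (upTo N)) ≤_) (length-upTo k)
      (length-injection (λ i y → i + y ≡ last)
        (λ {i} {i′} {y} eq eq′ → +-cancelʳ-≡ y i i′ (trans eq (sym eq′)))
        (Unique.filter⁺ (λ i → meetsBlock? i u) (Unique.upTo⁺ N)) blocks-before-last)
      where
      open ≤-Reasoning
      last : ℕ
      last = pred (u + T) / L
      ≤last : ∀ i → i * L < u + T → i ≤ last
      ≤last i iL<u+T = subst (_≤ last) (m*n/n≡m i L) (/-monoˡ-≤ L (<⇒≤pred iL<u+T))
      last<i+k : ∀ i → u < i * L + T → last < i + k
      last<i+k i u<iL+T = m<n*o⇒m/o<n (begin-strict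
        pred (u + T)     ≤⟨ pred[n]≤n ⟩
        u + T            <⟨ +-monoˡ-< T u<iL+T ⟩
        i * L + T + T    ≡⟨ collect (i * L) T ⟩
        i * L + 2 * T    ≤⟨ +-monoʳ-≤ (i * L) 2T≤Lk ⟩
        i * L + L * k    ≡⟨ cong (i * L +_) (*-comm L k) ⟩
        i * L + k * L    ≡⟨ *-distribʳ-+ L i k ⟨
        (i + k) * L      ∎)
        where
        collect : ∀ a T → a + T + T ≡ a + 2 * T
        collect = solve-∀
      blocks-before-last : ∀ {i} → i ∈ filter (λ i → meetsBlock? i u) (upTo N) →
                           ∃ λ y → y ∈ upTo k × i + y ≡ last
      blocks-before-last {i} i∈ =
        let _ , iL<u+T , u<iL+T = ∈-filter⁻ (λ i → meetsBlock? i u) {xs = upTo N} i∈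
            i+[last∸i]≡last     = m+[n∸m]≡n (≤last i iL<u+T)
        in last ∸ i ,
           ∈-upTo⁺ (+-cancelˡ-< i _ _ (subst (_< i + k) (sym i+[last∸i]≡last) (last<i+k i u<iL+T))) ,
           i+[last∸i]≡last

  -- A job that S runs at τ < r + lam moves to slot r + lam of the copy delayed by r + lam - τ.
  module DelayedCopies {T lam : ℕ} {I : Instance} (wf : WellFormed lam I) (S : Schedule T lam I) where

    Copy : Set
    Copy = Fin (length (cals S)) × ℕ

    copies : List Copy
    copies = cartesianProduct (allFin (length (cals S))) (upTo (suc lam))

    length-copies : length copies ≡ length (cals S) * suc lam
    length-copies = trans (length-cartesianProduct (allFin (length (cals S))) (upTo (suc lam)))
      (cong₂ _*_ (length-tabulate {n = length (cals S)} id) (length-upTo (suc lam)))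

    startTime : Copy → ℕ
    startTime (c , e) = lookup (cals S) c + e

    delay slot : Job I → ℕ
    delay J = release I J + lam ∸ proj₂ (place S J)
    slot J  = proj₂ (place S J) + delay J

    copy : Job I → Copy
    copy J = proj₁ (place S J) , delay J

    copy-slot-injective : ∀ {J J′} → copy J ≡ copy J′ → slot J ≡ slot J′ → J ≡ J′
    copy-slot-injective {J} {J′} copy≡ slot≡ = inj S (cong₂ _,_ (cong proj₁ copy≡)
      (+-cancelʳ-≡ (delay J) _ _ (trans slot≡ (cong (proj₂ (place S J′) +_) (sym (cong proj₂ copy≡))))))

    copy∈copies : ∀ J → copy J ∈ copies
    copy∈copies J = ∈-cartesianProduct⁺ (∈-allFin _)
      (∈-upTo⁺ (s≤s (m≤n+o⇒m∸n≤o _ (proj₂ (place S J)) (+-monoˡ-≤ lam (rel S J)))))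

    release≤slot : ∀ J → release I J + lam ≤ slot J
    release≤slot J = m≤n+m∸n _ (proj₂ (place S J))

    slot<deadline : ∀ J → slot J < deadline I J
    slot<deadline J with ≤-total (release I J + lam) (proj₂ (place S J))
    ... | inj₁ r≤τ rewrite m≤n⇒m∸n≡0 r≤τ | +-identityʳ (proj₂ (place S J)) = dl S J
    ... | inj₂ τ≤r rewrite m+[n∸m]≡n τ≤r = subst (_≤ deadline I J) (+-suc (release I J) lam) (wf J)

    startTime≤slot : ∀ J → startTime (copy J) + lam ≤ slot J
    startTime≤slot J = subst (_≤ slot J) (xy∙z≈xz∙y (lookup (cals S) (proj₁ (place S J))) lam (delay J))
                         (+-monoˡ-≤ (delay J) (calLo S J))

    slot<endTime : ∀ J → slot J < startTime (copy J) + T + lam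
    slot<endTime J = subst (slot J <_) (rotate (lookup (cals S) (proj₁ (place S J))) lam T (delay J))
                       (+-monoˡ-< (delay J) (calHi S J))
      where
      rotate : ∀ a b c d → a + b + c + d ≡ a + d + c + b
      rotate = solve-∀

  module _ (T lam L : ℕ) {{L≢0 : NonZero L}} where

    open BlockwiseEDF T lam L

    module BlockCost {I : Instance} (wf : WellFormed lam I) (short : ShortWindows T lam L I)
      (S : Schedule T lam I) where

      open DelayedCopies wf S

      meets? : ∀ i (v : Copy) → Dec (MeetsBlock T L i (startTime v))
      meets? i v = meetsBlock? T L i (startTime v)

      meetingCopies : ℕ → List Copy
      meetingCopies i = filter (meets? i) copies

      copy-meets-block : ∀ J → MeetsBlock T L (release I J / L) (startTime (copy J))
      copy-meets-block J = +-cancelʳ-< lam _ _ block<end , +-cancelʳ-< lam _ _ start<blockEnd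
        where
        open ≤-Reasoning
        i : ℕ
        i = release I J / L
        block<end : i * L + lam < startTime (copy J) + T + lam
        block<end = begin-strict
          i * L + lam                   ≤⟨ +-monoˡ-≤ lam (m/n*n≤m (release I J) L) ⟩
          release I J + lam             ≤⟨ release≤slot J ⟩
          slot J                        <⟨ slot<endTime J ⟩
          startTime (copy J) + T + lam  ∎
        start<blockEnd : startTime (copy J) + lam < blockEnd i + lam
        start<blockEnd = begin-strict
          startTime (copy J) + lam      ≤⟨ startTime≤slot J ⟩
          slot J                        <⟨ slot<deadline J ⟩
          deadline I J                  ≤⟨ m∸n≤o⇒m≤n+o _ lam (dueDate≤blockEnd I wf short (proj₁ J) (proj₂ J)) ⟩
          lam + blockEnd i              ≡⟨ +-comm lam _ ⟩
          blockEnd i + lam              ∎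

      arrivals-unique : ∀ i u → Unique (arrivals I i u)
      arrivals-unique i u = Unique.filter⁺ (inBlock? i)
        (Unique.map⁺ {f = task u (arr I u)} (λ eq → toℕ-injective (cong (λ j → proj₂ (jobId j)) eq))
          (Unique.allFin⁺ _))

      seen-unique : ∀ i t → Unique (seen (arrivals I i) t)
      seen-unique i t = concatMap-unique (arrivals I i) releaseDate (arrivals-unique i)
        (λ {u} j∈ → proj₁ (arrivals-admissible I wf short i u j∈)) (Unique.downFrom⁺ t)

      taskOf : Job I → Task
      taskOf (u , f) = task u (arr I u) f

      Occupies : Task → Copy × ℕ → Set
      Occupies j (v , τ) = ∃ λ J → j ≡ taskOf J × v ≡ copy J × τ ≡ slot J

      occupies-injective : ∀ {j j′ p} → Occupies j p → Occupies j′ p → j ≡ j′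
      occupies-injective (J , refl , v≡ , τ≡) (J′ , refl , v≡′ , τ≡′) =
        cong taskOf (copy-slot-injective (trans (sym v≡) v≡′) (trans (sym τ≡) τ≡′))

      slot∈window : ∀ {b l} J → b ≤ release I J → deadline I J ∸ lam ≤ suc (b + l) →
                    slot J ∈ applyUpTo (lam + b +_) (suc l)
      slot∈window {b} {l} J b≤r d≤D = subst (_∈ applyUpTo (lam + b +_) (suc l)) (m+[n∸m]≡n b≤slot)
        (∈-applyUpTo⁺ (lam + b +_)
          (+-cancelˡ-< (lam + b) _ _ (subst (_< lam + b + suc l) (sym (m+[n∸m]≡n b≤slot)) slot<D)))
        where
        open ≤-Reasoning
        b≤slot : lam + b ≤ slot J
        b≤slot = ≤-trans (≤-reflexive (+-comm lam b)) (≤-trans (+-monoˡ-≤ lam b≤r) (release≤slot J))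
        slot<D : slot J < lam + b + suc l
        slot<D = begin-strict
          slot J                <⟨ slot<deadline J ⟩
          deadline I J          ≤⟨ m∸n≤o⇒m≤n+o _ lam d≤D ⟩
          lam + suc (b + l)     ≡⟨ cong (lam +_) (+-suc b l) ⟨
          lam + (b + suc l)     ≡⟨ +-assoc lam b (suc l) ⟨
          lam + b + suc l       ∎

      windowCount≤meetingCopies : ∀ i t b l →
        windowCount b (suc (b + l)) (seen (arrivals I i) t) ≤ length (meetingCopies i) * suc l
      windowCount≤meetingCopies i t b l = begin
        windowCount b D (seen (arrivals I i) t)
          ≤⟨ length-injection Occupies occupies-injective (Unique.filter⁺ (inWindow? b D) (seen-unique i t)) occupied ⟩
        length (cartesianProduct (meetingCopies i) slots)
          ≡⟨ length-cartesianProduct (meetingCopies i) slots ⟩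
        length (meetingCopies i) * length slots
          ≡⟨ cong (length (meetingCopies i) *_) (length-applyUpTo (lam + b +_) (suc l)) ⟩
        length (meetingCopies i) * suc l
          ∎
        where
        open ≤-Reasoning
        D : ℕ
        D = suc (b + l)
        slots : List ℕ
        slots = applyUpTo (lam + b +_) (suc l)
        occupied : ∀ {j} → j ∈ filter (inWindow? b D) (seen (arrivals I i) t) →
                   ∃ λ p → p ∈ cartesianProduct (meetingCopies i) slots × Occupies j p
        occupied j∈ with ∈-filter⁻ (inWindow? b D) {xs = seen (arrivals I i) t} j∈
        ... | j∈seen , b≤r , d≤D with ∈-concatMap⁻′ (arrivals I i) {downFrom t} j∈seen
        ... | u , _ , j∈u with ∈-block⁻ (arr I) u j∈u
        ... | refl , f , refl = (copy (u , f) , slot (u , f)) ,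
          ∈-cartesianProduct⁺ (∈-filter⁺ (meets? i) (copy∈copies (u , f)) (copy-meets-block (u , f)))
                              (slot∈window (u , f) b≤r d≤D) ,
          (u , f) , refl , refl , refl

      block-cost : ∀ i N → ∑ (downFrom N) (opened (blockEnd i) (arrivals I i)) ≤ 3 * length (meetingCopies i)
      block-cost i N = begin
        ∑ (downFrom N) (opened (blockEnd i) (arrivals I i))
          ≡⟨ ∑-opened≡capacity (blockEnd i) (arrivals I i) N ⟩
        3 * peakDensity (blockEnd i) (seen (arrivals I i) N)
          ≤⟨ *-monoʳ-≤ 3 (peakDensity-lub (blockEnd i) (seen (arrivals I i) N) (length (meetingCopies i))
               (windowCount≤meetingCopies i N)) ⟩
        3 * length (meetingCopies i)
          ∎
        where open ≤-Reasoning

      ∑-meetingCopies≤ : ∀ k → 2 * T ≤ L * k →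
        ∀ N → ∑[ i ∈ upTo N ] length (meetingCopies i) ≤ length (cals S) * suc lam * k
      ∑-meetingCopies≤ k 2T≤Lk N = begin
        ∑[ i ∈ upTo N ] length (meetingCopies i)
          ≡⟨ ∑-cong (upTo N) (λ {i} _ → ∑-1≡length (meetingCopies i)) ⟨
        ∑[ i ∈ upTo N ] ∑[ v ∈ meetingCopies i ] 1
          ≡⟨ ∑-filter-swap (λ v i → meets? i v) copies (upTo N) (λ _ _ → 1) ⟩
        ∑[ v ∈ copies ] ∑[ i ∈ blocksMet v ] 1
          ≡⟨ ∑-cong copies (λ {v} _ → ∑-1≡length (blocksMet v)) ⟩
        ∑[ v ∈ copies ] length (blocksMet v)
          ≤⟨ ∑-mono-≤ copies (λ {v} _ → blocks-met≤ T L k 2T≤Lk N (startTime v)) ⟩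
        ∑[ v ∈ copies ] k
          ≡⟨ ∑-const copies k ⟩
        length copies * k
          ≡⟨ cong (_* k) length-copies ⟩
        length (cals S) * suc lam * k
          ∎
        where
        open ≤-Reasoning
        blocksMet : Copy → List ℕ
        blocksMet v = filter (λ i → meets? i v) (upTo N)

      competitive : ∀ k → 2 * T ≤ L * k → ∀ N → algCalibs algorithm I N ≤ 3 * (length (cals S) * suc lam * k)
      competitive k 2T≤Lk N = begin
        ∑[ t ∈ upTo N ] calibs (dec algorithm I t)
          ≡⟨ ∑-upTo≡∑-downFrom N _ ⟩
        ∑[ t ∈ downFrom N ] calibs (dec algorithm I t)
          ≤⟨ ∑-mono-≤ (downFrom N) (λ t∈ → opened-by-some-block (∈-downFrom⁻ t∈)) ⟩
        ∑[ t ∈ downFrom N ] ∑[ i ∈ upTo N ] openedFor i t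
          ≡⟨ ∑-swap (downFrom N) (upTo N) (λ t i → openedFor i t) ⟩
        ∑[ i ∈ upTo N ] ∑[ t ∈ downFrom N ] openedFor i t
          ≤⟨ ∑-mono-≤ (upTo N) (λ {i} _ → block-cost i N) ⟩
        ∑[ i ∈ upTo N ] (3 * length (meetingCopies i))
          ≡⟨ *-distribˡ-∑ 3 (upTo N) _ ⟨
        3 * (∑[ i ∈ upTo N ] length (meetingCopies i))
          ≤⟨ *-monoʳ-≤ 3 (∑-meetingCopies≤ k 2T≤Lk N) ⟩
        3 * (length (cals S) * suc lam * k)
          ∎
        where
        open ≤-Reasoning
        openedFor : ℕ → ℕ → ℕ
        openedFor i t = opened (blockEnd i) (arrivals I i) t
        opened-by-some-block : ∀ {t} → t < N → calibs (dec algorithm I t) ≤ ∑[ i ∈ upTo N ] openedFor i t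
        opened-by-some-block {t} t<N = subst (_≤ ∑[ i ∈ upTo N ] openedFor i t) (sym (calibs≡opened I t))
          (∈⇒≤∑ (λ i → openedFor i t) (∈-upTo⁺ (≤-<-trans (m/n≤m t L) t<N)))

module Rationals where

  open import Data.Integer as ℤ using (ℤ; +_; -[1+_]; +[1+_])
  open import Data.Integer.DivMod using ([n/d]*d≤n)
  import Data.Integer.Properties as ℤ
  open import Data.Nat as ℕ using (ℕ; zero; suc; _!) renaming (_≤_ to _≤ℕ_)
  import Data.Nat.Coprimality as Coprime
  import Data.Nat.Properties as ℕ
  open import Data.Nat.Tactic.RingSolver using (solve-∀)
  open import Data.Product using (∃; _×_; _,_; proj₁; proj₂)
  open import Data.Rational
  open import Data.Rational.Properties
  open import Data.Rational.Solver using (module +-*-Solver)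
  import Data.Rational.Unnormalised as ℚᵘ
  import Data.Rational.Unnormalised.Properties as ℚᵘ
  open import Relation.Binary.PropositionalEquality
  open import Defs
  open Blocks using (ShortWindows)
  open Arithmetic using (_⌈/⌉_; m+n⌈/⌉k≤o)

  ℕ→ℚ≡mkℚ : ∀ n → ℕ→ℚ n ≡ mkℚ (+ n) 0 (Coprime.sym (Coprime.1-coprimeTo n))
  ℕ→ℚ≡mkℚ n = normalize-coprime (Coprime.sym (Coprime.1-coprimeTo n))

  ℕ→ℚ-+ : ∀ m n → ℕ→ℚ (m ℕ.+ n) ≡ ℕ→ℚ m + ℕ→ℚ n
  ℕ→ℚ-+ m n rewrite ℕ→ℚ≡mkℚ m | ℕ→ℚ≡mkℚ n =
    cong (_/ 1) (sym (cong₂ ℤ._+_ (ℤ.*-identityʳ (+ m)) (ℤ.*-identityʳ (+ n))))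

  ℕ→ℚ-* : ∀ m n → ℕ→ℚ (m ℕ.* n) ≡ ℕ→ℚ m * ℕ→ℚ n
  ℕ→ℚ-* m n rewrite ℕ→ℚ≡mkℚ m | ℕ→ℚ≡mkℚ n = cong (_/ 1) (ℤ.pos-* m n)

  ℕ→ℚ-mono-≤ : ∀ {m n} → m ℕ.≤ n → ℕ→ℚ m ≤ ℕ→ℚ n
  ℕ→ℚ-mono-≤ {m} {n} m≤n rewrite ℕ→ℚ≡mkℚ m | ℕ→ℚ≡mkℚ n =
    *≤* (subst₂ ℤ._≤_ (sym (ℤ.*-identityʳ (+ m))) (sym (ℤ.*-identityʳ (+ n))) (ℤ.+≤+ m≤n))

  ℕ→ℚ-cancel-≤ : ∀ {m n} → ℕ→ℚ m ≤ ℕ→ℚ n → m ℕ.≤ n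
  ℕ→ℚ-cancel-≤ {m} {n} m≤n rewrite ℕ→ℚ≡mkℚ m | ℕ→ℚ≡mkℚ n =
    ℤ.drop‿+≤+ (subst₂ ℤ._≤_ (ℤ.*-identityʳ (+ m)) (ℤ.*-identityʳ (+ n)) (drop-*≤* m≤n))

  ℕ→ℚ-nonNeg : ∀ n → NonNegative (ℕ→ℚ n)
  ℕ→ℚ-nonNeg n = normalize-nonNeg n 1

  *ℕ→ℚ-mono-≤ : ∀ n {p q} → p ≤ q → p * ℕ→ℚ n ≤ q * ℕ→ℚ n
  *ℕ→ℚ-mono-≤ n = *-monoʳ-≤-nonNeg (ℕ→ℚ n) {{ℕ→ℚ-nonNeg n}}

  p≤p+q : ∀ p q .{{_ : NonNegative q}} → p ≤ p + q
  p≤p+q p q = subst (_≤ p + q) (+-identityʳ p) (+-monoʳ-≤ p (nonNegative⁻¹ q))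

  floor*↧≤↥ : ∀ p → floor p ℤ.* ↧ p ℤ.≤ ↥ p
  floor*↧≤↥ p@record{} = [n/d]*d≤n (↥ p) (↧ p)

  ≤-ceiling : ∀ p → p ≤ ℤ→ℚ (ceiling p)
  ≤-ceiling p@record{} =
    toℚᵘ-cancel-≤ (ℚᵘ.≤-respʳ-≃ (ℚᵘ.≃-sym (toℚᵘ-fromℚᵘ (ℚᵘ.mkℚᵘ (ceiling p) 0))) (ℚᵘ.*≤* ↥p≤⌈p⌉*↧p))
    where
    open ℤ.≤-Reasoning
    ↥p≤⌈p⌉*↧p : ↥ p ℤ.* + 1 ℤ.≤ ceiling p ℤ.* ↧ p
    ↥p≤⌈p⌉*↧p = begin
      ↥ p ℤ.* + 1                    ≡⟨ ℤ.*-identityʳ (↥ p) ⟩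
      ↥ p                            ≡⟨ ℤ.neg-involutive (↥ p) ⟨
      ℤ.- (ℤ.- ↥ p)                  ≡⟨ cong ℤ.-_ (↥-neg p) ⟨
      ℤ.- (↥ (- p))                  ≤⟨ ℤ.neg-mono-≤ (floor*↧≤↥ (- p)) ⟩
      ℤ.- (floor (- p) ℤ.* ↧ (- p))  ≡⟨ ℤ.neg-distribˡ-* (floor (- p)) (↧ (- p)) ⟩
      ceiling p ℤ.* ↧ (- p)          ≡⟨ cong (ceiling p ℤ.*_) (↧-neg p) ⟩
      ceiling p ℤ.* ↧ p              ∎

  ℤ→ℚ-positive⇒suc : ∀ z → 0ℚ < ℤ→ℚ z → ∃ λ n → z ≡ +[1+ n ]
  ℤ→ℚ-positive⇒suc +[1+ n ]  _   = n , refl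
  ℤ→ℚ-positive⇒suc (+ zero)  0<0 with 0<0
  ... | *<* (ℤ.+<+ ())
  ℤ→ℚ-positive⇒suc -[1+ m ]  0<z rewrite ℕ→ℚ≡mkℚ (suc m) with 0<z
  ... | *<* ()

  ceiling[2÷q]-spec : ∀ q .{{_ : Positive q}} →
    ∃ λ n → ceiling (_÷_ (ℕ→ℚ 2) q {{pos⇒nonZero q}}) ≡ +[1+ n ] × ℕ→ℚ 2 ≤ ℕ→ℚ (suc n) * q
  ceiling[2÷q]-spec q = n , c≡1+n , (begin
    ℕ→ℚ 2                  ≡⟨ *-identityʳ (ℕ→ℚ 2) ⟨
    ℕ→ℚ 2 * 1ℚ             ≡⟨ cong (ℕ→ℚ 2 *_) (*-inverseˡ q) ⟨
    ℕ→ℚ 2 * (1/ q * q)     ≡⟨ *-assoc (ℕ→ℚ 2) (1/ q) q ⟨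
    ℕ→ℚ 2 ÷ q * q          ≤⟨ *-monoʳ-≤-nonNeg q {{pos⇒nonNeg q}} (≤-ceiling (ℕ→ℚ 2 ÷ q)) ⟩
    ℤ→ℚ c * q              ≡⟨ cong (λ z → ℤ→ℚ z * q) c≡1+n ⟩
    ℕ→ℚ (suc n) * q        ∎)
    where
    open ≤-Reasoning
    instance
      q-nonZero : NonZero q
      q-nonZero = pos⇒nonZero q
    c : ℤ
    c = ceiling (ℕ→ℚ 2 ÷ q)
    2÷q-positive : Positive (ℕ→ℚ 2 ÷ q)
    2÷q-positive = pos*pos⇒pos (ℕ→ℚ 2) (1/ q) {{1/pos⇒pos q}}
    c-positive : ∃ λ n → c ≡ +[1+ n ]
    c-positive = ℤ→ℚ-positive⇒suc c
      (<-≤-trans (positive⁻¹ (ℕ→ℚ 2 ÷ q) {{2÷q-positive}}) (≤-ceiling (ℕ→ℚ 2 ÷ q)))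
    n : ℕ
    n = proj₁ c-positive
    c≡1+n : c ≡ +[1+ n ]
    c≡1+n = proj₂ c-positive

  ceil2div1minus-spec : ∀ α → α < 1ℚ → ∃ λ n → ceil2div1minus α ≡ +[1+ n ] × ℕ→ℚ 2 ≤ ℕ→ℚ (suc n) * (1ℚ - α)
  ceil2div1minus-spec α α<1 with 1ℚ - α | subst (_< 1ℚ - α) (+-inverseʳ α) (+-monoˡ-< (- α) α<1)
  ... | q@(mkℚ +[1+ _ ] _ _) | _ = ceiling[2÷q]-spec q
  ... | mkℚ -[1+ _ ] _ _     | *<* ()
  ... | mkℚ (+ zero) _ _     | *<* (ℤ.+<+ ())

  2≤eSum : ∀ n → ℕ→ℚ 2 ≤ eSum (suc n)
  2≤eSum zero    = ≤-refl
  2≤eSum (suc n) = ≤-trans (2≤eSum n)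
    (p≤p+q (eSum (suc n)) _ {{normalize-nonNeg 1 (suc (suc n) !) {{suc (suc n) ℕ.!≢0}}}})

  aboveE⇒2≤ : ∀ {q} → AboveE q → ℕ→ℚ 2 ≤ q
  aboveE⇒2≤ (n , eUpper≤q) = ≤-trans (≤-trans (2≤eSum n) (p≤p+q (eSum (suc n)) _
    {{normalize-nonNeg 1 (suc n ℕ.* suc n !) {{ℕ.m*n≢0 (suc n) (suc n !) {{_}} {{suc n ℕ.!≢0}}}}}})) eUpper≤q

  k*w+2T≤k*[l+T] : ∀ α k w l T → ℕ→ℚ 2 ≤ ℕ→ℚ k * (1ℚ - α) → ℕ→ℚ w < α * ℕ→ℚ T + ℕ→ℚ l →
                    k ℕ.* w ℕ.+ 2 ℕ.* T ≤ℕ k ℕ.* (l ℕ.+ T)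
  k*w+2T≤k*[l+T] α k w l T 2≤k[1-α] w<αT+l = ℕ→ℚ-cancel-≤ (begin
    ℕ→ℚ (k ℕ.* w ℕ.+ 2 ℕ.* T)
      ≡⟨ ℕ→ℚ-+ (k ℕ.* w) (2 ℕ.* T) ⟩
    ℕ→ℚ (k ℕ.* w) + ℕ→ℚ (2 ℕ.* T)
      ≡⟨ cong₂ _+_ (ℕ→ℚ-* k w) (ℕ→ℚ-* 2 T) ⟩
    ℕ→ℚ k * ℕ→ℚ w + ℕ→ℚ 2 * ℕ→ℚ T
      ≤⟨ +-mono-≤ (*-monoˡ-≤-nonNeg (ℕ→ℚ k) {{ℕ→ℚ-nonNeg k}} (<⇒≤ w<αT+l)) (*ℕ→ℚ-mono-≤ T 2≤k[1-α]) ⟩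
    ℕ→ℚ k * (α * ℕ→ℚ T + ℕ→ℚ l) + ℕ→ℚ k * (1ℚ - α) * ℕ→ℚ T
      ≡⟨ cancel-α (ℕ→ℚ k) α (ℕ→ℚ T) (ℕ→ℚ l) ⟩
    ℕ→ℚ k * (ℕ→ℚ l + ℕ→ℚ T)
      ≡⟨ cong (ℕ→ℚ k *_) (ℕ→ℚ-+ l T) ⟨
    ℕ→ℚ k * ℕ→ℚ (l ℕ.+ T)
      ≡⟨ ℕ→ℚ-* k (l ℕ.+ T) ⟨
    ℕ→ℚ (k ℕ.* (l ℕ.+ T))
      ∎)
    where
    open ≤-Reasoning
    cancel-α : ∀ k α T l → k * (α * T + l) + k * (1ℚ - α) * T ≡ k * (l + T)
    cancel-α = solve 4 (λ k α T l → k :* (α :* T :+ l) :+ k :* (con 1ℚ :- α) :* T := k :* (l :+ T)) refl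
      where open +-*-Solver

  alphaShort⇒shortWindows : ∀ α T lam k .{{_ : ℕ.NonZero k}} → ℕ→ℚ 2 ≤ ℕ→ℚ k * (1ℚ - α) →
    ∀ I → WellFormed lam I → AlphaShort α T lam I → ShortWindows T lam ((2 ℕ.* T) ⌈/⌉ k) I
  alphaShort⇒shortWindows α T lam k 2≤k[1-α] I wf short j = begin
    d ℕ.+ L             ≡⟨ cong (ℕ._+ L) (ℕ.m+[n∸m]≡n r≤d) ⟨
    r ℕ.+ w ℕ.+ L       ≡⟨ ℕ.+-assoc r w L ⟩
    r ℕ.+ (w ℕ.+ L)     ≤⟨ ℕ.+-monoʳ-≤ r (m+n⌈/⌉k≤o w (2 ℕ.* T) k kw+2T≤k[lam+T]) ⟩
    r ℕ.+ (lam ℕ.+ T)   ≡⟨ ℕ.+-assoc r lam T ⟨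
    r ℕ.+ lam ℕ.+ T     ∎
    where
    open ℕ.≤-Reasoning
    L r d w : ℕ
    L = (2 ℕ.* T) ⌈/⌉ k
    r = release I j
    d = deadline I j
    w = d ℕ.∸ r
    r≤d : r ≤ℕ d
    r≤d = ℕ.m+n≤o⇒m≤o r (wf j)
    kw+2T≤k[lam+T] : k ℕ.* w ℕ.+ 2 ℕ.* T ≤ℕ k ℕ.* (lam ℕ.+ T)
    kw+2T≤k[lam+T] = k*w+2T≤k*[l+T] α k w lam T 2≤k[1-α] (short j)

  3[abc]≤[q+1]bca : ∀ {q} → ℕ→ℚ 2 ≤ q → ∀ a b c →
    ℕ→ℚ (3 ℕ.* (a ℕ.* b ℕ.* c)) ≤ (q + 1ℚ) * ℕ→ℚ b * ℕ→ℚ c * ℕ→ℚ a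
  3[abc]≤[q+1]bca {q} 2≤q a b c = begin
    ℕ→ℚ (3 ℕ.* (a ℕ.* b ℕ.* c))        ≡⟨ cong ℕ→ℚ (regroup a b c) ⟩
    ℕ→ℚ (3 ℕ.* b ℕ.* c ℕ.* a)          ≡⟨ ℕ→ℚ-* (3 ℕ.* b ℕ.* c) a ⟩
    ℕ→ℚ (3 ℕ.* b ℕ.* c) * ℕ→ℚ a        ≡⟨ cong (_* ℕ→ℚ a) (ℕ→ℚ-* (3 ℕ.* b) c) ⟩
    ℕ→ℚ (3 ℕ.* b) * ℕ→ℚ c * ℕ→ℚ a      ≡⟨ cong (λ p → p * ℕ→ℚ c * ℕ→ℚ a) (ℕ→ℚ-* 3 b) ⟩
    ℕ→ℚ 3 * ℕ→ℚ b * ℕ→ℚ c * ℕ→ℚ a      ≤⟨ *ℕ→ℚ-mono-≤ a (*ℕ→ℚ-mono-≤ c (*ℕ→ℚ-mono-≤ b (+-monoˡ-≤ 1ℚ 2≤q))) ⟩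
    (q + 1ℚ) * ℕ→ℚ b * ℕ→ℚ c * ℕ→ℚ a   ∎
    where
    open ≤-Reasoning
    regroup : ∀ a b c → 3 ℕ.* (a ℕ.* b ℕ.* c) ≡ 3 ℕ.* b ℕ.* c ℕ.* a
    regroup = solve-∀

open import Defs
open import Data.Nat as ℕ using (ℕ; suc) renaming (_≤_ to _≤ℕ_)
open import Data.Integer using (+_)
open import Data.Rational using (ℚ; _<_; _≤_; _+_; _*_; _/_; 1ℚ)
open import Data.List using (length)
open import Data.Product using (Σ; _×_; _,_)
open import Data.Rational.Properties using (+-identityʳ; module ≤-Reasoning)
open import Relation.Binary.PropositionalEquality using (cong)
open Arithmetic using (_⌈/⌉_; m≤m⌈/⌉n*n; m⌈/⌉n≢0)
open Blocks using (module BlockwiseEDF)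
open Cost using (module BlockCost)
open Rationals

theorem2 : (α : ℚ) → (+ 0 / 1) < α → α < (+ 1 / 1) →
    (lam : ℕ) → (T : ℕ) → 1 ≤ℕ T →
    Σ OnlineAlg λ A → Σ ℕ λ a →
      ∀ (I : Instance) → WellFormed lam I → AlphaShort α T lam I →
        Feasible T lam A I
        × (∀ (S : Schedule T lam I) (q : ℚ) → AboveE q → (N : ℕ) →
             ℕ→ℚ (algCalibs A I N)
               ≤ (q + (+ 1 / 1)) * ℕ→ℚ (suc lam) * ℤ→ℚ (ceil2div1minus α)
                   * ℕ→ℚ (length (cals S)) + ℕ→ℚ a)
theorem2 α _ α<1 lam T@(suc _) _ with ceil2div1minus-spec α α<1
... | n , ceil≡k , 2≤k[1-α] = algorithm , 0 , λ I wf short →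
  let windows-short = alphaShort⇒shortWindows α T lam k 2≤k[1-α] I wf short in
  feasible I wf windows-short , λ S q q>e N → let c = length (cals S) in begin
    ℕ→ℚ (algCalibs algorithm I N)
      ≤⟨ ℕ→ℚ-mono-≤ (BlockCost.competitive T lam L wf windows-short S k (m≤m⌈/⌉n*n (2 ℕ.* T) k) N) ⟩
    ℕ→ℚ (3 ℕ.* (c ℕ.* suc lam ℕ.* k))
      ≤⟨ 3[abc]≤[q+1]bca (aboveE⇒2≤ q>e) c (suc lam) k ⟩
    (q + 1ℚ) * ℕ→ℚ (suc lam) * ℕ→ℚ k * ℕ→ℚ c
      ≡⟨ cong (λ z → (q + 1ℚ) * ℕ→ℚ (suc lam) * ℤ→ℚ z * ℕ→ℚ c) ceil≡k ⟨
    (q + 1ℚ) * ℕ→ℚ (suc lam) * ℤ→ℚ (ceil2div1minus α) * ℕ→ℚ c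
      ≡⟨ +-identityʳ _ ⟨
    (q + 1ℚ) * ℕ→ℚ (suc lam) * ℤ→ℚ (ceil2div1minus α) * ℕ→ℚ c + ℕ→ℚ 0
      ∎
  where
  open ≤-Reasoning
  k L : ℕ
  k = suc n
  L = (2 ℕ.* T) ⌈/⌉ k
  instance
    L≢0 : ℕ.NonZero L
    L≢0 = m⌈/⌉n≢0 (2 ℕ.* T) k
  open BlockwiseEDF T lam L
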